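{- Let $\mathcal L$ be the honeycomb lattice graph, with $\mathbf v_1=\left(\frac32,\frac{\sqrt3}2\right)$ and $\mathbf v_2=\left(\frac32,-\frac{\sqrt3}2\right)$. Let \[ \Lambda_Q=\mathbb Z(2\mathbf v_1)+\mathbb Z(2\mathbf v_2),\qquad \Lambda_{X_3}=\mathbb Z(2\mathbf v_1+2\mathbf v_2)+\mathbb Z(4\mathbf v_1-2\mathbf v_2), \] regarded as groups of translations of $\mathbb R^2$, let $R$ be the half-turn rotation of $\mathbb R^2$ around the origin $(0,0)$, and let $G_{K_4}=\Lambda_Q\rtimes\langle R\rangle$ (resp. $G_T=\Lambda_{X_3}\rtimes\langle R\rangle$) be the group of isometries of $\mathbb R^2$ generated by $R$ together with the translations by vectors in $\Lambda_Q$ (resp. $\Lambda_{X_3}$). Then the four groups $G_{K_4},\Lambda_Q,G_T,\Lambda_{X_3}$ act on the honeycomb lattice graph $\mathcal L$ as graph automorphisms, and \[ K_4\cong\mathcal L/G_{K_4},\qquad Q\cong\mathcal L/\Lambda_Q,\qquad T\cong\mathcal L/G_T,\qquad X_3\cong\mathcal L/\Lambda_{X_3}, \] where $K_4$ is the complete graph on 4 vertices, $Q$ is the cube graph, $T$ is the truncated tetrahedron graph, and $X_3=\mathrm{Cay}(\mathfrak S_4,\{(1,4),(2,4),(3,4)\})$ is the star graph.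
   Context: The honeycomb (hexagonal) lattice graph $\mathcal L$ is the infinite bipartite graph with vertex set $B\cup W\subset\mathbb R^2$, where $B=(1,0)+\mathbb Z\mathbf v_1+\mathbb Z\mathbf v_2$ and $W=(0,0)+\mathbb Z\mathbf v_1+\mathbb Z\mathbf v_2$; $b\in B$ and $w\in W$ are joined by an edge iff $\|b-w\|=1$, and there are no edges within $B$ or within $W$. For a group $G$ acting on a graph by automorphisms, the quotient graph has the $G$-orbits of vertices as vertices, two orbits being adjacent iff some representatives are adjacent. The cube graph is the 1-skeleton of the 3-dimensional cube. The truncated tetrahedron graph is the 1-skeleton of the truncated tetrahedron (12 vertices, 3-regular). $\mathfrak S_4$ is the symmetric group on $\{1,2,3,4\}$, and $\mathrm{Cay}(G,S)$ is the simple undirected graph with vertex set $G$ in which $\xi,\eta$ are adjacent iff $\eta=\xi s$ for some $s\in S$.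
   Formalization: The half-turn R is centred at the hexagon centre (-1,0) instead of (0,0): about the vertex (0,0) it sends the vertex (1,0) to (-1,0), which is not a vertex, so G_{K_4} and G_T would not act on the honeycomb; the plane is represented by points with coordinates in Q(√3). -}

module Defs where

open import Algebra.Bundles using (Group)
open import Data.Fin using (Fin; inject₁)
open import Data.Fin.Patterns
open import Data.Fin.Permutation using (Permutation′; _⟨$⟩ʳ_; _⟨$⟩ˡ_; _∘ₚ_; flip; transpose)
import Data.Fin.Permutation as Perm
open import Data.Fin.Properties using (all?) renaming (_≟_ to _≟ᶠ_)
open import Data.Integer.Base as ℤ using (ℤ; +_; -[1+_]; 0ℤ)
import Data.Integer.Properties as ℤₚ
open import Data.Nat.Base using (ℕ)
import Data.Nat.Divisibility as ℕ∣
open import Data.Product using (Σ; Σ-syntax; ∃-syntax; ∃₂; _×_; _,_; proj₁; proj₂)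
open import Data.Rational as ℚ using (ℚ; 0ℚ; 1ℚ; ½)
import Data.Rational.Properties as ℚₚ
open import Data.Rational.Literals using (fromℤ)
open import Data.Rational.Solver using (module +-*-Solver)
open import Data.Sum using (_⊎_; inj₁; inj₂; [_,_]′; swap)
import Data.Sum as Sum
open import Data.Vec using (Vec; []; _∷_; lookup; zipWith; foldr)
open import Function using (_∘_; _⇔_; Inverse; _↔_)
open import Function.Construct.Composition using (_↔-∘_)
open import Function.Construct.Identity using (↔-id)
open import Function.Construct.Symmetry using (↔-sym)
open import Function.Bundles using (mk↔ₛ′)
open import Level using (0ℓ)
open import Relation.Binary using (Rel; Setoid; Symmetric; _Respects₂_)
open import Relation.Binary.PropositionalEquality as ≡
  using (_≡_; _≢_; refl; sym; trans; cong; cong₂; subst; module ≡-Reasoning)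
open import Relation.Nullary using (¬_)
open import Relation.Nullary.Decidable using (toWitness; toWitnessFalse)
open import Relation.Unary using (Pred; _∈_; _∪_)

-- Undirected graphs without multiple edges.  Loops are not excluded, so
-- that a quotient may a priori have them; vertices form a setoid, so
-- that quotients can be formed at all.
record Graph : Set₁ where
  field
    vertices : Setoid 0ℓ 0ℓ
  open Setoid vertices public renaming (Carrier to Vertex)
  field
    Adj      : Rel Vertex 0ℓ
    Adj-sym  : Symmetric Adj
    Adj-resp : Adj Respects₂ _≈_

infix 4 _≅_
record _≅_ (Γ Δ : Graph) : Set where
  private
    module Γ = Graph Γ
    module Δ = Graph Δ
  field
    bijection : Inverse Γ.vertices Δ.vertices
  open Inverse bijection public using (to; from)
  field
    adjacency : ∀ u v → Γ.Adj u v ⇔ Δ.Adj (to u) (to v)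

module _ (G : Group 0ℓ 0ℓ) where
  open Group G using (Carrier; _≈_; _∙_; ε; _⁻¹)

  record Subgroup : Set₁ where
    field
      Member    : Pred Carrier 0ℓ
      resp      : ∀ {g h} → g ≈ h → Member g → Member h
      ε-closed  : Member ε
      ∙-closed  : ∀ {g h} → Member g → Member h → Member (g ∙ h)
      ⁻¹-closed : ∀ {g} → Member g → Member (g ⁻¹)

  data Generated (S : Pred Carrier 0ℓ) : Pred Carrier 0ℓ where
    generator : ∀ {g} → S g → Generated S g
    resp      : ∀ {g h} → g ≈ h → Generated S g → Generated S h
    unit      : Generated S ε
    product   : ∀ {g h} → Generated S g → Generated S h → Generated S (g ∙ h)
    inverse   : ∀ {g} → Generated S g → Generated S (g ⁻¹)

module _ {G : Group 0ℓ 0ℓ} where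
  private module G = Group G

  ⟨_⟩ : Pred G.Carrier 0ℓ → Subgroup G
  ⟨ S ⟩ = record
    { Member    = Generated G S
    ; resp      = resp
    ; ε-closed  = unit
    ; ∙-closed  = product
    ; ⁻¹-closed = inverse
    }

  asGroup : Subgroup G → Group 0ℓ 0ℓ
  asGroup H = record
    { Carrier = Σ G.Carrier H.Member
    ; _≈_     = λ g h → proj₁ g G.≈ proj₁ h
    ; _∙_     = λ g h → proj₁ g G.∙ proj₁ h , H.∙-closed (proj₂ g) (proj₂ h)
    ; ε       = G.ε , H.ε-closed
    ; _⁻¹     = λ g → proj₁ g G.⁻¹ , H.⁻¹-closed (proj₂ g)
    ; isGroup = record
      { isMonoid = record
        { isSemigroup = record
          { isMagma = record
            { isEquivalence = record { refl = G.refl ; sym = G.sym ; trans = G.trans }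
            ; ∙-cong        = G.∙-cong
            }
          ; assoc = λ _ _ _ → G.assoc _ _ _
          }
        ; identity = (λ _ → G.identityˡ _) , (λ _ → G.identityʳ _)
        }
      ; inverse = (λ _ → G.inverseˡ _) , (λ _ → G.inverseʳ _)
      ; ⁻¹-cong = G.⁻¹-cong
      }
    }
    where module H = Subgroup H

record Action (G : Group 0ℓ 0ℓ) (Γ : Graph) : Set where
  private
    module G = Group G
    module Γ = Graph Γ
  infixr 8 _·_
  field
    _·_        : G.Carrier → Γ.Vertex → Γ.Vertex
    ·-cong     : ∀ {g h u v} → g G.≈ h → u Γ.≈ v → g · u Γ.≈ h · v
    ε-action   : ∀ v → G.ε · v Γ.≈ v
    ∙-action   : ∀ g h v → (g G.∙ h) · v Γ.≈ g · h · v
    adjacency  : ∀ g u v → Γ.Adj u v ⇔ Γ.Adj (g · u) (g · v)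

infix 6 _/_
_/_ : ∀ {G} (Γ : Graph) → Action G Γ → Graph
_/_ {G} Γ α = record
  { vertices = record
    { Carrier       = Γ.Vertex
    ; _≈_           = _∼_
    ; isEquivalence = record { refl = ∼-refl ; sym = ∼-sym ; trans = ∼-trans }
    }
  ; Adj      = λ u v → ∃₂ λ u′ v′ → u ∼ u′ × v ∼ v′ × Γ.Adj u′ v′
  ; Adj-sym  = λ (u′ , v′ , u∼u′ , v∼v′ , e) → v′ , u′ , v∼v′ , u∼u′ , Γ.Adj-sym e
  ; Adj-resp = (λ w∼v (u′ , v′ , u∼u′ , w∼v′ , e) →
                  u′ , v′ , u∼u′ , ∼-trans (∼-sym w∼v) w∼v′ , e)
             , (λ w∼v (u′ , v′ , w∼u′ , u∼v′ , e) →
                  u′ , v′ , ∼-trans (∼-sym w∼v) w∼u′ , u∼v′ , e)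
  }
  where
  module G = Group G
  module Γ = Graph Γ
  open Action α

  _∼_ : Rel Γ.Vertex 0ℓ
  u ∼ v = ∃[ g ] g · u Γ.≈ v

  ∼-refl : ∀ {u} → u ∼ u
  ∼-refl = G.ε , ε-action _

  ∼-sym : ∀ {u v} → u ∼ v → v ∼ u
  ∼-sym (g , gu≈v) = g G.⁻¹ ,
    Γ.trans (·-cong G.refl (Γ.sym gu≈v))
    (Γ.trans (Γ.sym (∙-action (g G.⁻¹) g _))
    (Γ.trans (·-cong (G.inverseˡ g) Γ.refl) (ε-action _)))

  ∼-trans : ∀ {u v w} → u ∼ v → v ∼ w → u ∼ w
  ∼-trans (g , gu≈v) (h , hv≈w) = h G.∙ g ,
    Γ.trans (∙-action h g _) (Γ.trans (·-cong G.refl gu≈v) hv≈w)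

infix 5 _⊕_√3
record ℚ√3 : Set where
  constructor _⊕_√3
  field
    rat irr : ℚ
open ℚ√3

infixl 6 _+_ _-_
infixl 7 _*_

_+_ _-_ _*_ : ℚ√3 → ℚ√3 → ℚ√3
(a ⊕ b √3) + (c ⊕ d √3) = a ℚ.+ c ⊕ b ℚ.+ d √3
(a ⊕ b √3) - (c ⊕ d √3) = a ℚ.- c ⊕ b ℚ.- d √3
(a ⊕ b √3) * (c ⊕ d √3) = a ℚ.* c ℚ.+ fromℤ (+ 3) ℚ.* (b ℚ.* d) ⊕ a ℚ.* d ℚ.+ b ℚ.* c √3

rational : ℚ → ℚ√3
rational q = q ⊕ 0ℚ √3

record Point : Set where
  constructor ⟪_,_⟫
  field
    x y : ℚ√3
open Point

infixl 6 _+ᵥ_ _-ᵥ_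
infixr 7 _•_

_+ᵥ_ _-ᵥ_ : Point → Point → Point
p +ᵥ q = ⟪ x p + x q , y p + y q ⟫
p -ᵥ q = ⟪ x p - x q , y p - y q ⟫

_•_ : ℤ → Point → Point
m • p = ⟪ rational (fromℤ m) * x p , rational (fromℤ m) * y p ⟫

‖_‖² : Point → ℚ√3
‖ p ‖² = x p * x p + y p * y p

origin e₁ v₁ v₂ : Point
origin = ⟪ rational 0ℚ , rational 0ℚ ⟫
e₁     = ⟪ rational 1ℚ , rational 0ℚ ⟫
v₁     = ⟪ rational (+ 3 ℚ./ 2) , 0ℚ ⊕ ½ √3 ⟫
v₂     = ⟪ rational (+ 3 ℚ./ 2) , 0ℚ ⊕ ℚ.- ½ √3 ⟫

ext : ∀ {p q : Point} → rat (x p) ≡ rat (x q) → irr (x p) ≡ irr (x q) →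
      rat (y p) ≡ rat (y q) → irr (y p) ≡ irr (y q) → p ≡ q
ext refl refl refl refl = refl

open +-*-Solver

+ᵥ-identityˡ : ∀ p → origin +ᵥ p ≡ p
+ᵥ-identityˡ p = ext (ℚₚ.+-identityˡ _) (ℚₚ.+-identityˡ _) (ℚₚ.+-identityˡ _) (ℚₚ.+-identityˡ _)

+ᵥ-assoc : ∀ p q r → (p +ᵥ q) +ᵥ r ≡ p +ᵥ (q +ᵥ r)
+ᵥ-assoc p q r = ext (ℚₚ.+-assoc (rat (x p)) (rat (x q)) (rat (x r)))
                     (ℚₚ.+-assoc (irr (x p)) (irr (x q)) (irr (x r)))
                     (ℚₚ.+-assoc (rat (y p)) (rat (y q)) (rat (y r)))
                     (ℚₚ.+-assoc (irr (y p)) (irr (y q)) (irr (y r)))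

t+p-t : ∀ t p → (t +ᵥ p) -ᵥ t ≡ p
t+p-t t p = ext (e (rat (x t)) (rat (x p)))
                (e (irr (x t)) (irr (x p)))
                (e (rat (y t)) (rat (y p)))
                (e (irr (y t)) (irr (y p)))
  where
  e : ∀ a b → (a ℚ.+ b) ℚ.- a ≡ b
  e = solve 2 (λ a b → (a :+ b) :- a := b) refl

t+[p-t] : ∀ t p → t +ᵥ (p -ᵥ t) ≡ p
t+[p-t] t p = ext (e (rat (x t)) (rat (x p)))
                  (e (irr (x t)) (irr (x p)))
                  (e (rat (y t)) (rat (y p)))
                  (e (irr (y t)) (irr (y p)))
  where
  e : ∀ a b → a ℚ.+ (b ℚ.- a) ≡ b
  e = solve 2 (λ a b → a :+ (b :- a) := b) refl

t+p-[t+q] : ∀ t p q → (t +ᵥ p) -ᵥ (t +ᵥ q) ≡ p -ᵥ q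
t+p-[t+q] t p q = ext (e (rat (x t)) (rat (x p)) (rat (x q)))
                      (e (irr (x t)) (irr (x p)) (irr (x q)))
                      (e (rat (y t)) (rat (y p)) (rat (y q)))
                      (e (irr (y t)) (irr (y p)) (irr (y q)))
  where
  e : ∀ a b c → (a ℚ.+ b) ℚ.- (a ℚ.+ c) ≡ b ℚ.- c
  e = solve 3 (λ a b c → (a :+ b) :- (a :+ c) := b :- c) refl

d-[d-p] : ∀ d p → d -ᵥ (d -ᵥ p) ≡ p
d-[d-p] d p = ext (e (rat (x d)) (rat (x p)))
                  (e (irr (x d)) (irr (x p)))
                  (e (rat (y d)) (rat (y p)))
                  (e (irr (y d)) (irr (y p)))
  where
  e : ∀ a b → a ℚ.- (a ℚ.- b) ≡ b
  e = solve 2 (λ a b → a :- (a :- b) := b) refl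

d-p-[d-q] : ∀ d p q → (d -ᵥ p) -ᵥ (d -ᵥ q) ≡ q -ᵥ p
d-p-[d-q] d p q = ext (e (rat (x d)) (rat (x p)) (rat (x q)))
                      (e (irr (x d)) (irr (x p)) (irr (x q)))
                      (e (rat (y d)) (rat (y p)) (rat (y q)))
                      (e (irr (y d)) (irr (y p)) (irr (y q)))
  where
  e : ∀ a b c → (a ℚ.- b) ℚ.- (a ℚ.- c) ≡ c ℚ.- b
  e = solve 3 (λ a b c → (a :- b) :- (a :- c) := c :- b) refl

square-swap : ∀ a b → (a - b) * (a - b) ≡ (b - a) * (b - a)
square-swap (a ⊕ b √3) (c ⊕ d √3) = cong₂ _⊕_√3
  (solve 4 (λ a b c d →
     (a :- c) :* (a :- c) :+ con (fromℤ (+ 3)) :* ((b :- d) :* (b :- d)) :=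
     (c :- a) :* (c :- a) :+ con (fromℤ (+ 3)) :* ((d :- b) :* (d :- b))) refl a b c d)
  (solve 4 (λ a b c d →
     (a :- c) :* (b :- d) :+ (b :- d) :* (a :- c) :=
     (c :- a) :* (d :- b) :+ (d :- b) :* (c :- a)) refl a b c d)

‖-‖²-swap : ∀ p q → ‖ p -ᵥ q ‖² ≡ ‖ q -ᵥ p ‖²
‖-‖²-swap p q = cong₂ _+_ (square-swap (x p) (x q)) (square-swap (y p) (y q))

record Isometry : Set where
  field
    bijection : Point ↔ Point
  open Inverse bijection public using (to; from; strictlyInverseˡ; strictlyInverseʳ)
  field
    isometric : ∀ p q → ‖ to p -ᵥ to q ‖² ≡ ‖ p -ᵥ q ‖²
open Isometry using (to; from)

isometries : Group 0ℓ 0ℓ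
isometries = record
  { Carrier = Isometry
  ; _≈_     = λ g h → ∀ p → to g p ≡ to h p
  ; _∙_     = λ g h → record
      { bijection = Isometry.bijection g ↔-∘ Isometry.bijection h
      ; isometric = λ p q → trans (Isometry.isometric g _ _) (Isometry.isometric h p q)
      }
  ; ε       = record { bijection = ↔-id _ ; isometric = λ _ _ → refl }
  ; _⁻¹     = λ g → record
      { bijection = ↔-sym (Isometry.bijection g)
      ; isometric = λ p q → trans (sym (Isometry.isometric g _ _))
          (cong₂ (λ p q → ‖ p -ᵥ q ‖²) (Isometry.strictlyInverseˡ g p) (Isometry.strictlyInverseˡ g q))
      }
  ; isGroup = record
    { isMonoid = record
      { isSemigroup = record
        { isMagma = record
          { isEquivalence = record
            { refl  = λ _ → refl
            ; sym   = λ e p → sym (e p)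
            ; trans = λ e f p → trans (e p) (f p)
            }
          ; ∙-cong = λ {g} {_} {_} {k} e f p → trans (cong (to g) (f p)) (e (to k p))
          }
        ; assoc = λ _ _ _ _ → refl
        }
      ; identity = (λ _ _ → refl) , (λ _ _ → refl)
      }
    ; inverse = (λ g → Isometry.strictlyInverseʳ g) , (λ g → Isometry.strictlyInverseˡ g)
    ; ⁻¹-cong = λ {g} {h} e p →
        trans (cong (from g) (sym (trans (e _) (Isometry.strictlyInverseˡ h p))))
              (Isometry.strictlyInverseʳ g _)
    }
  }

translation : Point → Isometry
translation t = record
  { bijection = mk↔ₛ′ (λ p → t +ᵥ p) (λ p → p -ᵥ t) (t+[p-t] t) (t+p-t t)
  ; isometric = λ p q → cong ‖_‖² (t+p-[t+q] t p q)
  }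

halfTurn : Point → Isometry
halfTurn c = record
  { bijection = mk↔ₛ′ f f (d-[d-p] (c +ᵥ c)) (d-[d-p] (c +ᵥ c))
  ; isometric = λ p q → trans (cong ‖_‖² (d-p-[d-q] (c +ᵥ c) p q)) (‖-‖²-swap q p)
  }
  where
  f : Point → Point
  f p = (c +ᵥ c) -ᵥ p

/1 : ∀ i → i ℚ./ 1 ≡ fromℤ i
/1 i = ℚₚ.↥p/↧p≡p (fromℤ i)

fromℤ-+ : ∀ i j → fromℤ (i ℤ.+ j) ≡ fromℤ i ℚ.+ fromℤ j
fromℤ-+ i j = sym (trans
  (cong (ℚ._/ 1) (cong₂ ℤ._+_ (ℤₚ.*-identityʳ i) (ℤₚ.*-identityʳ j))) (/1 _))

fromℤ-neg : ∀ i → fromℤ (ℤ.- i) ≡ ℚ.- fromℤ i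
fromℤ-neg (+ 0)      = refl
fromℤ-neg ℤ.+[1+ n ] = refl
fromℤ-neg -[1+ n ]   = refl

scale : ∀ (z : ℚ√3) m → rational (fromℤ m) * z ≡ (fromℤ m ℚ.* rat z ⊕ fromℤ m ℚ.* irr z √3)
scale z m = cong₂ _⊕_√3
  (solve 3 (λ m a b → m :* a :+ con (fromℤ (+ 3)) :* (con 0ℚ :* b) := m :* a) refl
    (fromℤ m) (rat z) (irr z))
  (solve 3 (λ m a b → m :* b :+ con 0ℚ :* a := m :* b) refl
    (fromℤ m) (rat z) (irr z))

scaleᵥ : ∀ m p → m • p ≡ ⟪ fromℤ m ℚ.* rat (x p) ⊕ fromℤ m ℚ.* irr (x p) √3
                         , fromℤ m ℚ.* rat (y p) ⊕ fromℤ m ℚ.* irr (y p) √3 ⟫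
scaleᵥ m p = cong₂ ⟪_,_⟫ (scale (x p) m) (scale (y p) m)

combine : ∀ m n u v → m • u +ᵥ n • v ≡
  ⟪ fromℤ m ℚ.* rat (x u) ℚ.+ fromℤ n ℚ.* rat (x v) ⊕ fromℤ m ℚ.* irr (x u) ℚ.+ fromℤ n ℚ.* irr (x v) √3
  , fromℤ m ℚ.* rat (y u) ℚ.+ fromℤ n ℚ.* rat (y v) ⊕ fromℤ m ℚ.* irr (y u) ℚ.+ fromℤ n ℚ.* irr (y v) √3 ⟫
combine m n u v = cong₂ _+ᵥ_ (scaleᵥ m u) (scaleᵥ n v)

combine-0 : ∀ u v → 0ℤ • u +ᵥ 0ℤ • v ≡ origin
combine-0 u v = trans (combine 0ℤ 0ℤ u v) (ext (e (rat (x u)) (rat (x v)))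
       (e (irr (x u)) (irr (x v)))
       (e (rat (y u)) (rat (y v)))
       (e (irr (y u)) (irr (y v))))
  where
  e : ∀ a b → 0ℚ ℚ.* a ℚ.+ 0ℚ ℚ.* b ≡ 0ℚ
  e = solve 2 (λ a b → con 0ℚ :* a :+ con 0ℚ :* b := con 0ℚ) refl

combine-+ : ∀ m n m′ n′ u v →
  (m • u +ᵥ n • v) +ᵥ (m′ • u +ᵥ n′ • v) ≡ (m ℤ.+ m′) • u +ᵥ (n ℤ.+ n′) • v
combine-+ m n m′ n′ u v = trans (cong₂ _+ᵥ_ (combine m n u v) (combine m′ n′ u v))
  (trans (ext (e (rat (x u)) (rat (x v)))
       (e (irr (x u)) (irr (x v)))
       (e (rat (y u)) (rat (y v)))
       (e (irr (y u)) (irr (y v)))) (sym (combine (m ℤ.+ m′) (n ℤ.+ n′) u v)))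
  where
  e : ∀ a b → (fromℤ m ℚ.* a ℚ.+ fromℤ n ℚ.* b) ℚ.+ (fromℤ m′ ℚ.* a ℚ.+ fromℤ n′ ℚ.* b)
            ≡ fromℤ (m ℤ.+ m′) ℚ.* a ℚ.+ fromℤ (n ℤ.+ n′) ℚ.* b
  e a b = trans
    (solve 6 (λ m n m′ n′ a b → (m :* a :+ n :* b) :+ (m′ :* a :+ n′ :* b) :=
       (m :+ m′) :* a :+ (n :+ n′) :* b) refl (fromℤ m) (fromℤ n) (fromℤ m′) (fromℤ n′) a b)
    (sym (cong₂ (λ s t → s ℚ.* a ℚ.+ t ℚ.* b) (fromℤ-+ m m′) (fromℤ-+ n n′)))

combine-neg : ∀ m n u v p →
  p -ᵥ (m • u +ᵥ n • v) ≡ ((ℤ.- m) • u +ᵥ (ℤ.- n) • v) +ᵥ p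
combine-neg m n u v p = trans (cong (p -ᵥ_) (combine m n u v))
  (trans (ext (e (rat (x u)) (rat (x v)) (rat (x p)))
       (e (irr (x u)) (irr (x v)) (irr (x p)))
       (e (rat (y u)) (rat (y v)) (rat (y p)))
       (e (irr (y u)) (irr (y v)) (irr (y p))))
         (cong (_+ᵥ p) (sym (combine (ℤ.- m) (ℤ.- n) u v))))
  where
  e : ∀ a b c → c ℚ.- (fromℤ m ℚ.* a ℚ.+ fromℤ n ℚ.* b)
              ≡ (fromℤ (ℤ.- m) ℚ.* a ℚ.+ fromℤ (ℤ.- n) ℚ.* b) ℚ.+ c
  e a b c = trans
    (solve 5 (λ m n a b c → c :- (m :* a :+ n :* b) := (:- m :* a :+ :- n :* b) :+ c) refl
      (fromℤ m) (fromℤ n) a b c)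
    (sym (cong₂ (λ s t → (s ℚ.* a ℚ.+ t ℚ.* b) ℚ.+ c) (fromℤ-neg m) (fromℤ-neg n)))

-- ℤu + ℤv as a group of translations.
translations : Point → Point → Subgroup isometries
translations u v = record
  { Member    = λ g → ∃₂ λ m n → ∀ p → to g p ≡ to (translation (m • u +ᵥ n • v)) p
  ; resp      = λ e (m , n , f) → m , n , λ p → trans (sym (e p)) (f p)
  ; ε-closed  = 0ℤ , 0ℤ , λ p → sym (trans (cong (_+ᵥ p) (combine-0 u v)) (+ᵥ-identityˡ p))
  ; ∙-closed  = λ {_} {h} (m , n , e) (m′ , n′ , f) → m ℤ.+ m′ , n ℤ.+ n′ , λ p →
      trans (e (to h p)) (trans (cong ((m • u +ᵥ n • v) +ᵥ_) (f p))
        (trans (sym (+ᵥ-assoc (m • u +ᵥ n • v) (m′ • u +ᵥ n′ • v) p))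
               (cong (_+ᵥ p) (combine-+ m n m′ n′ u v))))
  ; ⁻¹-closed = λ {g} (m , n , e) → ℤ.- m , ℤ.- n , λ p →
      trans (sym (t+p-t (m • u +ᵥ n • v) (from g p)))
        (trans (cong (_-ᵥ (m • u +ᵥ n • v))
                 (trans (sym (e (from g p))) (Isometry.strictlyInverseˡ g p)))
               (combine-neg m n u v p))
  }

-- Λ ⋊ ⟨ R ⟩, for R the half-turn about c.
_⋊halfTurn_ : Subgroup isometries → Point → Subgroup isometries
Λ ⋊halfTurn c = ⟨ Subgroup.Member Λ ∪ (λ g → ∀ p → to g p ≡ to (halfTurn c) p) ⟩

coset : Point → Point → Point → Pred Point 0ℓ
coset o u v p = ∃₂ λ m n → p ≡ o +ᵥ (m • u +ᵥ n • v)

B W : Pred Point 0ℓ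
B = coset e₁ v₁ v₂
W = coset origin v₁ v₂

-- As norms are nonnegative, ‖ b - w ‖ = 1 is expressed by squared norms.
Edge : Point → Point → Set
Edge b w = b ∈ B × w ∈ W × ‖ b -ᵥ w ‖² ≡ rational 1ℚ

record HoneycombVertex : Set where
  constructor vertex
  field
    point    : Point
    isVertex : point ∈ B ∪ W
open HoneycombVertex public

𝓛 : Graph
𝓛 = record
  { vertices = record
    { Carrier       = HoneycombVertex
    ; _≈_           = λ u v → point u ≡ point v
    ; isEquivalence = record { refl = refl ; sym = sym ; trans = trans }
    }
  ; Adj      = λ u v → Edge (point u) (point v) ⊎ Edge (point v) (point u)
  ; Adj-sym  = swap
  ; Adj-resp = (λ e → Sum.map (subst (Edge _) e) (subst (λ p → Edge p _) e))
             , (λ e → Sum.map (subst (λ p → Edge p _) e) (subst (Edge _) e))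
  }

-- An action on 𝓛 given by applying the isometries to the vertices.
record HoneycombAction (H : Subgroup isometries) : Set where
  field
    action : Action (asGroup H) 𝓛
  open Action action public
  field
    agrees : ∀ g v → point (g · v) ≡ to (proj₁ g) (point v)

Λ-Q Λ-X₃ : Subgroup isometries
Λ-Q  = translations (+ 2 • v₁) (+ 2 • v₂)
Λ-X₃ = translations (+ 2 • v₁ +ᵥ + 2 • v₂) (+ 4 • v₁ -ᵥ + 2 • v₂)

-- The half-turn R has to be centred at a hexagon of 𝓛.  The point (0,0)
-- will not do: it is a vertex in W, of degree 3, and the half-turn about
-- it sends the vertex (1,0) to (-1,0), the centre of a hexagon (see
-- no-action-at-origin).  Centring R at (-1,0) instead is equivalent to
-- keeping R at (0,0) and replacing W by (-1,0) + ℤv₁ + ℤv₂, up to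
-- translation and exchange of the two colours.
hexagonCentre : Point
hexagonCentre = ⟪ rational (ℚ.- 1ℚ) , rational 0ℚ ⟫

G-K₄ G-T : Subgroup isometries
G-K₄ = Λ-Q  ⋊halfTurn hexagonCentre
G-T  = Λ-X₃ ⋊halfTurn hexagonCentre

private
  fromℤ-injective : ∀ {i j} → fromℤ i ≡ fromℤ j → i ≡ j
  fromℤ-injective = cong ℚ.numerator

  rat-x : ∀ o m n → rat (x (o +ᵥ (m • v₁ +ᵥ n • v₂)))
                  ≡ rat (x o) ℚ.+ fromℤ (m ℤ.+ n) ℚ.* (+ 3 ℚ./ 2)
  rat-x o m n = cong (rat (x o) ℚ.+_) (begin
    rat (x (m • v₁ +ᵥ n • v₂))
      ≡⟨ cong (rat ∘ x) (combine m n v₁ v₂) ⟩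
    fromℤ m ℚ.* (+ 3 ℚ./ 2) ℚ.+ fromℤ n ℚ.* (+ 3 ℚ./ 2)
      ≡⟨ sym (ℚₚ.*-distribʳ-+ (+ 3 ℚ./ 2) (fromℤ m) (fromℤ n)) ⟩
    (fromℤ m ℚ.+ fromℤ n) ℚ.* (+ 3 ℚ./ 2)
      ≡⟨ cong (ℚ._* (+ 3 ℚ./ 2)) (sym (fromℤ-+ m n)) ⟩
    fromℤ (m ℤ.+ n) ℚ.* (+ 3 ℚ./ 2) ∎)
    where open ≡-Reasoning

  3k : ∀ k → fromℤ (k ℤ.+ (k ℤ.+ k)) ≡ fromℤ k ℚ.* (+ 3 ℚ./ 2) ℚ.* fromℤ (+ 2)
  3k k = trans (trans (fromℤ-+ k _) (cong (fromℤ k ℚ.+_) (fromℤ-+ k k)))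
    (solve 1 (λ k → k :+ (k :+ k) := k :* con (+ 3 ℚ./ 2) :* con (fromℤ (+ 2))) refl (fromℤ k))

  3∣ : ∀ k i → k ℤ.+ (k ℤ.+ k) ≡ i → 3 ℕ∣.∣ ℤ.∣ i ∣
  3∣ k _ refl = ℕ∣.divides ℤ.∣ k ∣ (trans (cong ℤ.∣_∣ eq) (ℤₚ.abs-* k (+ 3)))
    where
    eq : k ℤ.+ (k ℤ.+ k) ≡ k ℤ.* + 3
    eq = sym (trans (ℤₚ.*-comm k (+ 3)) (trans (ℤₚ.suc-* (+ 2) k) (cong (λ z → k ℤ.+ z)
           (trans (ℤₚ.suc-* (+ 1) k) (cong (λ z → k ℤ.+ z) (ℤₚ.*-identityˡ k))))))

  impossible : ∀ o i → ¬ (3 ℕ∣.∣ ℤ.∣ i ∣) →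
    (ℚ.- 1ℚ ℚ.- rat (x o)) ℚ.* fromℤ (+ 2) ≡ fromℤ i →
    ¬ coset o v₁ v₂ (to (halfTurn origin) e₁)
  impossible o i 3∤i oi (m , n , e) = 3∤i (3∣ (m ℤ.+ n) i (fromℤ-injective (begin
    fromℤ (k ℤ.+ (k ℤ.+ k))                        ≡⟨ 3k k ⟩
    fromℤ k ℚ.* (+ 3 ℚ./ 2) ℚ.* fromℤ (+ 2)        ≡⟨ cong (ℚ._* fromℤ (+ 2)) (solve 2 (λ a b → b := (a :+ b) :- a) refl (rat (x o)) _) ⟩
    ((rat (x o) ℚ.+ fromℤ k ℚ.* (+ 3 ℚ./ 2)) ℚ.- rat (x o)) ℚ.* fromℤ (+ 2)
                                                   ≡⟨ cong (λ z → (z ℚ.- rat (x o)) ℚ.* fromℤ (+ 2)) (sym (trans (cong (rat ∘ x) e) (rat-x o m n))) ⟩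
    (ℚ.- 1ℚ ℚ.- rat (x o)) ℚ.* fromℤ (+ 2)         ≡⟨ oi ⟩
    fromℤ i ∎)))
    where
    open ≡-Reasoning
    k = m ℤ.+ n

no-action-at-origin : ∀ Λ → ¬ HoneycombAction (Λ ⋊halfTurn origin)
no-action-at-origin Λ α = [ impossible e₁ -[1+ 3 ] (toWitnessFalse {a? = 3 ℕ∣.∣? 4} _) refl
                          , impossible origin -[1+ 1 ] (toWitnessFalse {a? = 3 ℕ∣.∣? 2} _) refl
                          ]′ (subst (_∈ B ∪ W) (agrees R v) (isVertex (R · v)))
  where
  open HoneycombAction α
  R : Group.Carrier (asGroup (Λ ⋊halfTurn origin))
  R = halfTurn origin , generator (inj₂ (λ _ → refl))
  v : HoneycombVertex
  v = vertex e₁ (inj₁ (0ℤ , 0ℤ , refl))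

complete : ℕ → Graph
complete n = record
  { vertices = ≡.setoid (Fin n)
  ; Adj      = _≢_
  ; Adj-sym  = λ u≢v → u≢v ∘ sym
  ; Adj-resp = (λ { refl → λ e → e }) , (λ { refl → λ e → e })
  }

K₄ : Graph
K₄ = complete 4

_⊙_ : ∀ {d} → Vec ℤ d → Vec ℤ d → ℤ
a ⊙ b = foldr (λ _ → ℤ) ℤ._+_ 0ℤ (zipWith ℤ._*_ a b)

-- The 1-skeleton of the convex hull of ps, which are to be its distinct
-- extreme points: i and j are joined iff some linear functional attains
-- its maximum over ps at exactly these two points.  For integral ps a
-- face is exposed by an integral functional as soon as by a real one.
skeleton : ∀ {d n} → Vec (Vec ℤ d) n → Graph
skeleton {d} {n} ps = record
  { vertices = ≡.setoid (Fin n)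
  ; Adj      = λ i j → i ≢ j × Exposes i j
  ; Adj-sym  = λ (i≢j , c , e , f) → i≢j ∘ sym , c , sym e ,
                 λ k k≢j k≢i → subst (c ⊙ lookup ps k ℤ.<_) e (f k k≢i k≢j)
  ; Adj-resp = (λ { refl → λ e → e }) , (λ { refl → λ e → e })
  }
  where
  Exposes : Fin n → Fin n → Set
  Exposes i j = Σ[ c ∈ Vec ℤ d ] c ⊙ lookup ps i ≡ c ⊙ lookup ps j
              × (∀ k → k ≢ i → k ≢ j → c ⊙ lookup ps k ℤ.< c ⊙ lookup ps i)

private
  1# -1# 3# -3# : ℤ
  1#  = + 1
  -1# = -[1+ 0 ]
  3#  = + 3
  -3# = -[1+ 2 ]

cubeVertices : Vec (Vec ℤ 3) 8
cubeVertices =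
  ( 1# ∷  1# ∷  1# ∷ []) ∷ ( 1# ∷  1# ∷ -1# ∷ []) ∷
  ( 1# ∷ -1# ∷  1# ∷ []) ∷ ( 1# ∷ -1# ∷ -1# ∷ []) ∷
  (-1# ∷  1# ∷  1# ∷ []) ∷ (-1# ∷  1# ∷ -1# ∷ []) ∷
  (-1# ∷ -1# ∷  1# ∷ []) ∷ (-1# ∷ -1# ∷ -1# ∷ []) ∷ []

-- The points 2tᵢ + tⱼ, i ≠ j, for the regular tetrahedron with vertices
-- t = (1,1,1), (1,-1,-1), (-1,1,-1), (-1,-1,1): three times the points
-- that trisect its edges.
truncatedTetrahedronVertices : Vec (Vec ℤ 3) 12
truncatedTetrahedronVertices =
  ( 3# ∷  1# ∷  1# ∷ []) ∷ ( 1# ∷  3# ∷  1# ∷ []) ∷ ( 1# ∷  1# ∷  3# ∷ []) ∷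
  ( 3# ∷ -1# ∷ -1# ∷ []) ∷ ( 1# ∷ -3# ∷ -1# ∷ []) ∷ ( 1# ∷ -1# ∷ -3# ∷ []) ∷
  (-3# ∷  1# ∷ -1# ∷ []) ∷ (-1# ∷  3# ∷ -1# ∷ []) ∷ (-1# ∷  1# ∷ -3# ∷ []) ∷
  (-3# ∷ -1# ∷  1# ∷ []) ∷ (-1# ∷ -3# ∷  1# ∷ []) ∷ (-1# ∷ -1# ∷  3# ∷ []) ∷ []

Q T : Graph
Q = skeleton cubeVertices
T = skeleton truncatedTetrahedronVertices

-- ξη = ξ ∘ η, whereas _∘ₚ_ composes from left to right.
symmetricGroup : ℕ → Group 0ℓ 0ℓ
symmetricGroup n = record
  { Carrier = Permutation′ n
  ; _≈_     = Perm._≈_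
  ; _∙_     = λ ξ η → η ∘ₚ ξ
  ; ε       = Perm.id
  ; _⁻¹     = flip
  ; isGroup = record
    { isMonoid = record
      { isSemigroup = record
        { isMagma = record
          { isEquivalence = record
            { refl  = λ _ → refl
            ; sym   = λ e i → sym (e i)
            ; trans = λ e f i → trans (e i) (f i)
            }
          ; ∙-cong = λ {ξ} {_} {_} {η′} e f i → trans (cong (ξ ⟨$⟩ʳ_) (f i)) (e (η′ ⟨$⟩ʳ i))
          }
        ; assoc = λ _ _ _ _ → refl
        }
      ; identity = (λ _ _ → refl) , (λ _ _ → refl)
      }
    ; inverse = (λ ξ _ → Perm.inverseˡ ξ) , (λ ξ _ → Perm.inverseʳ ξ)
    ; ⁻¹-cong = λ {ξ} {η} e i →
        trans (cong (ξ ⟨$⟩ˡ_) (sym (trans (e (η ⟨$⟩ˡ i)) (Perm.inverseʳ η)))) (Perm.inverseˡ ξ)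
    }
  }

Cay : (G : Group 0ℓ 0ℓ) (S : Pred (Group.Carrier G) 0ℓ) →
      (∀ {s} → s ∈ S → Group._⁻¹ G s ∈ S) → Graph
Cay G S S⁻¹ = record
  { vertices = setoid
  ; Adj      = λ ξ η → ∃[ s ] s ∈ S × η ≈ ξ ∙ s
  ; Adj-sym  = λ {ξ} {η} (s , s∈S , e) → s ⁻¹ , S⁻¹ s∈S , G.trans (G.sym (identityʳ ξ))
                 (G.trans (∙-congˡ (G.sym (inverseʳ s)))
                 (G.trans (G.sym (assoc ξ s (s ⁻¹))) (∙-congʳ (G.sym e))))
  ; Adj-resp = (λ η≈ζ (s , s∈S , e) → s , s∈S , G.trans (G.sym η≈ζ) e)
             , (λ ξ≈ζ (s , s∈S , e) → s , s∈S , G.trans e (∙-congʳ ξ≈ζ))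
  }
  where
  module G = Group G
  open G using (setoid; _≈_; _∙_; _⁻¹; identityʳ; inverseʳ; assoc; ∙-congˡ; ∙-congʳ)

-- The transpositions (1,4), (2,4), (3,4), with 1, …, 4 numbered from 0.
starTranspositions : Pred (Permutation′ 4) 0ℓ
starTranspositions s = Σ[ i ∈ Fin 3 ] s Perm.≈ transpose (inject₁ i) 3F

private
  starTranspositions-⁻¹ : ∀ {s} → s ∈ starTranspositions → flip s ∈ starTranspositions
  starTranspositions-⁻¹ {s} (i , e) = i , λ j →
    trans (Group.⁻¹-cong (symmetricGroup 4) {s} {transpose (inject₁ i) 3F} e j) (involutive i j)
    where
    involutive : ∀ i j → flip (transpose (inject₁ i) 3F) ⟨$⟩ʳ j
                       ≡ transpose (inject₁ i) 3F ⟨$⟩ʳ j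
    involutive = toWitness {a? = all? λ i → all? λ j → _ ≟ᶠ _} _

X₃ : Graph
X₃ = Cay (symmetricGroup 4) starTranspositions (λ {s} → starTranspositions-⁻¹ {s})

{-# OPTIONS --safe #-}

-- Denote by black m n and white m n the vertices e₁ + m v₁ + n v₂ and
-- m v₁ + n v₂ of 𝓛.  Then black m n is adjacent to white m n, white (m + 1) n
-- and white m (n + 1), and the half-turn sends (m , n) of either colour to
-- (-1 - m , -1 - n) of the other one.  The lattices Λ-Q and Λ-X₃ are spanned by
-- k v₁ and 2 (v₁ + v₂) for k = 2 and k = 6, so that the Λ-orbit of a vertex is
-- given by its colour, m - n mod k and n mod 2; with the half-turn, every orbit
-- contains exactly one such class of white vertices.  Hence each isomorphism
-- amounts to a finite verification on explicit labels of the classes.  In the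
-- two polyhedral graphs, an edge is exposed by the sum of its end points as a
-- functional, and the midpoint of two nonadjacent vertices is a convex
-- combination of two further vertices.

module Submission where

open import Defs
open import Algebra.Bundles using (Group)
import Algebra.Properties.AbelianGroup
open import Data.Fin using (Fin; toℕ; fromℕ<; inject₁; #_)
open import Data.Fin.Patterns
open import Data.Fin.Permutation as Perm using (Permutation′; _⟨$⟩ʳ_; _⟨$⟩ˡ_; _∘ₚ_; transpose)
open import Data.Fin.Properties using (all?; any?; _≟_; toℕ-injective; toℕ-fromℕ<; toℕ<n)
open import Data.Integer as ℤ using (ℤ; +_; -[1+_]; 0ℤ)
import Data.Integer.DivMod as ℤ÷
import Data.Integer.Properties as ℤₚ
open import Data.Integer.Tactic.RingSolver using (solve-∀)
open import Data.Nat.Base as ℕ using (ℕ; zero; suc; NonZero)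
import Data.Nat.Divisibility as ℕ∣
open import Data.Nat.DivMod using (_mod_)
import Data.Nat.Properties as ℕₚ
open import Data.Product using (Σ; Σ-syntax; ∃; ∃₂; _×_; _,_; proj₁; proj₂; uncurry)
open import Data.Product.Properties using (≡-dec)
open import Data.Rational as ℚ using (ℚ; 0ℚ; 1ℚ; ½)
open import Data.Rational.Literals using (fromℤ)
import Data.Rational.Properties as ℚₚ
open import Data.Rational.Solver using (module +-*-Solver)
open import Data.Sum as Sum using (_⊎_; inj₁; inj₂)
open import Data.Vec using (Vec; []; _∷_; lookup; zipWith)
import Data.Vec.Properties as Vecₚ
open import Function using (_∘_; id; Injective; mk⇔)
open import Relation.Binary using (DecidableEquality)
open import Relation.Binary.PropositionalEquality
open import Relation.Nullary using (¬_; contradiction; Dec; yes; no; ¬?; _×-dec_; _⊎-dec_; _→-dec_)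
open import Relation.Nullary.Decidable using (map′; toWitness; toWitnessFalse)
open import Relation.Unary using (Decidable; _∈_; _∪_)
open ℚ√3
open Point
open Isometry using (to; from; isometric; strictlyInverseʳ)
open Subgroup using (Member; ⁻¹-closed)
open +-*-Solver using (solve; _:=_; _:+_; _:*_; _:-_; :-_; con)

private
  module I = Group isometries
  module ℤ+ = Algebra.Properties.AbelianGroup ℤₚ.+-0-abelianGroup

-- Sites of the honeycomb, and how translations and the half-turn move them.

data Colour : Set where
  black white : Colour

opposite : Colour → Colour
opposite black = white
opposite white = black

base : Colour → Point
base black = e₁
base white = origin

site : Colour → ℤ → ℤ → Point
site c m n = base c +ᵥ (m • v₁ +ᵥ n • v₂)

fromℤ-injective : ∀ {i j} → fromℤ i ≡ fromℤ j → i ≡ j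
fromℤ-injective = cong ℚ.numerator

fromℤ-* : ∀ i j → fromℤ (i ℤ.* j) ≡ fromℤ i ℚ.* fromℤ j
fromℤ-* i j = sym (/1 (i ℤ.* j))

+ᵥ-comm : ∀ p q → p +ᵥ q ≡ q +ᵥ p
+ᵥ-comm p q = ext (ℚₚ.+-comm _ (rat (x q))) (ℚₚ.+-comm _ (irr (x q)))
                  (ℚₚ.+-comm _ (rat (y q))) (ℚₚ.+-comm _ (irr (y q)))

+ᵥ-interchange : ∀ p q r s → (p +ᵥ q) +ᵥ (r +ᵥ s) ≡ (p +ᵥ r) +ᵥ (q +ᵥ s)
+ᵥ-interchange p q r s = begin
  (p +ᵥ q) +ᵥ (r +ᵥ s)  ≡⟨ +ᵥ-assoc p q (r +ᵥ s) ⟩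
  p +ᵥ (q +ᵥ (r +ᵥ s))  ≡⟨ cong (p +ᵥ_) (+ᵥ-assoc q r s) ⟨
  p +ᵥ ((q +ᵥ r) +ᵥ s)  ≡⟨ cong (λ t → p +ᵥ (t +ᵥ s)) (+ᵥ-comm q r) ⟩
  p +ᵥ ((r +ᵥ q) +ᵥ s)  ≡⟨ cong (p +ᵥ_) (+ᵥ-assoc r q s) ⟩
  p +ᵥ (r +ᵥ (q +ᵥ s))  ≡⟨ +ᵥ-assoc p r (q +ᵥ s) ⟨
  (p +ᵥ r) +ᵥ (q +ᵥ s)  ∎
  where open ≡-Reasoning

translation-site : ∀ a b c m n →
  to (translation (a • v₁ +ᵥ b • v₂)) (site c m n) ≡ site c (a ℤ.+ m) (b ℤ.+ n)
translation-site a b c m n = begin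
  t +ᵥ (base c +ᵥ u)  ≡⟨ +ᵥ-assoc t (base c) u ⟨
  (t +ᵥ base c) +ᵥ u  ≡⟨ cong (_+ᵥ u) (+ᵥ-comm t (base c)) ⟩
  (base c +ᵥ t) +ᵥ u  ≡⟨ +ᵥ-assoc (base c) t u ⟩
  base c +ᵥ (t +ᵥ u)  ≡⟨ cong (base c +ᵥ_) (combine-+ a b m n v₁ v₂) ⟩
  site c (a ℤ.+ m) (b ℤ.+ n) ∎
  where
  open ≡-Reasoning
  t = a • v₁ +ᵥ b • v₂
  u = m • v₁ +ᵥ n • v₂

-- The half-turn about a point sends p to twice that point minus p, so it suffices that a site and
-- its claimed image add up to twice the centre: the sum is e₁ - v₁ - v₂ = (-2, 0) for either
-- colour.
halfTurn-site : ∀ c m n →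
  to (halfTurn hexagonCentre) (site c m n) ≡ site (opposite c) (ℤ.-1ℤ ℤ.- m) (ℤ.-1ℤ ℤ.- n)
halfTurn-site c m n = begin
  d -ᵥ site c m n                             ≡⟨ cong (_-ᵥ site c m n) sum ⟨
  (site c m n +ᵥ site (opposite c) m′ n′) -ᵥ site c m n  ≡⟨ t+p-t (site c m n) _ ⟩
  site (opposite c) m′ n′                     ∎
  where
  open ≡-Reasoning
  m′ = ℤ.-1ℤ ℤ.- m
  n′ = ℤ.-1ℤ ℤ.- n
  b = base c +ᵥ base (opposite c)
  d = hexagonCentre +ᵥ hexagonCentre
  cancel : ∀ i → i ℤ.+ (ℤ.-1ℤ ℤ.- i) ≡ ℤ.-1ℤ
  cancel = solve-∀
  bases : ∀ c → (base c +ᵥ base (opposite c)) +ᵥ (ℤ.-1ℤ • v₁ +ᵥ ℤ.-1ℤ • v₂) ≡ d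
  bases black = refl
  bases white = refl
  sum : site c m n +ᵥ site (opposite c) m′ n′ ≡ d
  sum = begin
    site c m n +ᵥ site (opposite c) m′ n′
      ≡⟨ +ᵥ-interchange (base c) _ (base (opposite c)) _ ⟩
    b +ᵥ ((m • v₁ +ᵥ n • v₂) +ᵥ (m′ • v₁ +ᵥ n′ • v₂))
      ≡⟨ cong (b +ᵥ_) (combine-+ m n m′ n′ v₁ v₂) ⟩
    b +ᵥ ((m ℤ.+ m′) • v₁ +ᵥ (n ℤ.+ n′) • v₂)
      ≡⟨ cong₂ (λ i j → b +ᵥ (i • v₁ +ᵥ j • v₂)) (cancel m) (cancel n) ⟩
    b +ᵥ (ℤ.-1ℤ • v₁ +ᵥ ℤ.-1ℤ • v₂)
      ≡⟨ bases c ⟩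
    d ∎

•-combine : ∀ k m n → k • (m • v₁ +ᵥ n • v₂) ≡ (k ℤ.* m) • v₁ +ᵥ (k ℤ.* n) • v₂
•-combine k m n = begin
  k • (m • v₁ +ᵥ n • v₂)
    ≡⟨ scaleᵥ k (m • v₁ +ᵥ n • v₂) ⟩
  _
    ≡⟨ ext (e (rat (x v₁)) (rat (x v₂)) (cong (rat ∘ x) (combine m n v₁ v₂)))
           (e (irr (x v₁)) (irr (x v₂)) (cong (irr ∘ x) (combine m n v₁ v₂)))
           (e (rat (y v₁)) (rat (y v₂)) (cong (rat ∘ y) (combine m n v₁ v₂)))
           (e (irr (y v₁)) (irr (y v₂)) (cong (irr ∘ y) (combine m n v₁ v₂))) ⟩
  _
    ≡⟨ combine (k ℤ.* m) (k ℤ.* n) v₁ v₂ ⟨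
  (k ℤ.* m) • v₁ +ᵥ (k ℤ.* n) • v₂ ∎
  where
  open ≡-Reasoning
  e : ∀ {q} a b → q ≡ fromℤ m ℚ.* a ℚ.+ fromℤ n ℚ.* b →
      fromℤ k ℚ.* q ≡ fromℤ (k ℤ.* m) ℚ.* a ℚ.+ fromℤ (k ℤ.* n) ℚ.* b
  e a b refl = trans
    (solve 5 (λ k m n a b → k :* (m :* a :+ n :* b) := k :* m :* a :+ k :* n :* b) refl
      (fromℤ k) (fromℤ m) (fromℤ n) a b)
    (sym (cong₂ (λ s t → s ℚ.* a ℚ.+ t ℚ.* b) (fromℤ-* k m) (fromℤ-* k n)))

-- Recovering colour and coordinates of a site from its position.

offset : Colour → ℤ
offset black = + 2
offset white = + 0

abscissa : Colour → ℤ → ℤ → ℤ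
abscissa c m n = offset c ℤ.+ + 3 ℤ.* (m ℤ.+ n)

-- Site c m n is (a / 2 , (m - n) √3 / 2), for a = abscissa c m n.
site-coordinates : ∀ c m n →
  site c m n ≡ ⟪ rational (½ ℚ.* fromℤ (abscissa c m n)) , 0ℚ ⊕ ½ ℚ.* fromℤ (m ℤ.- n) √3 ⟫
site-coordinates c m n = trans (cong (base c +ᵥ_) (combine m n v₁ v₂)) (ext
  (begin
    rat (x (base c)) ℚ.+ (M ℚ.* (+ 3 ℚ./ 2) ℚ.+ N ℚ.* (+ 3 ℚ./ 2))
      ≡⟨ cong (ℚ._+ (M ℚ.* (+ 3 ℚ./ 2) ℚ.+ N ℚ.* (+ 3 ℚ./ 2))) (base-x c) ⟩
    ½ ℚ.* C ℚ.+ (M ℚ.* (+ 3 ℚ./ 2) ℚ.+ N ℚ.* (+ 3 ℚ./ 2))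
      ≡⟨ solve 3 (λ c m n → con ½ :* c :+ (m :* con (+ 3 ℚ./ 2) :+ n :* con (+ 3 ℚ./ 2))
           := con ½ :* (c :+ con (fromℤ (+ 3)) :* (m :+ n))) refl C M N ⟩
    ½ ℚ.* (C ℚ.+ fromℤ (+ 3) ℚ.* (M ℚ.+ N))
      ≡⟨ cong (½ ℚ.*_) (sym (trans (fromℤ-+ (offset c) _) (cong (C ℚ.+_)
           (trans (fromℤ-* (+ 3) (m ℤ.+ n)) (cong (fromℤ (+ 3) ℚ.*_) (fromℤ-+ m n)))))) ⟩
    ½ ℚ.* fromℤ (abscissa c m n) ∎)
  (trans (cong (ℚ._+ _) (base-irr c)) (zeros M N))
  (trans (cong (ℚ._+ _) (base-y c)) (zeros M N))
  (begin
    irr (y (base c)) ℚ.+ (M ℚ.* ½ ℚ.+ N ℚ.* (ℚ.- ½))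
      ≡⟨ cong (ℚ._+ (M ℚ.* ½ ℚ.+ N ℚ.* (ℚ.- ½))) (base-y-irr c) ⟩
    0ℚ ℚ.+ (M ℚ.* ½ ℚ.+ N ℚ.* (ℚ.- ½))
      ≡⟨ solve 2 (λ m n → con 0ℚ :+ (m :* con ½ :+ n :* con (ℚ.- ½)) := con ½ :* (m :+ :- n)) refl M N ⟩
    ½ ℚ.* (M ℚ.+ ℚ.- N)
      ≡⟨ cong (½ ℚ.*_) (sym (trans (fromℤ-+ m (ℤ.- n)) (cong (M ℚ.+_) (fromℤ-neg n)))) ⟩
    ½ ℚ.* fromℤ (m ℤ.- n) ∎))
  where
  open ≡-Reasoning
  M = fromℤ m
  N = fromℤ n
  C = fromℤ (offset c)
  zeros : ∀ a b → 0ℚ ℚ.+ (a ℚ.* 0ℚ ℚ.+ b ℚ.* 0ℚ) ≡ 0ℚ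
  zeros = solve 2 (λ a b → con 0ℚ :+ (a :* con 0ℚ :+ b :* con 0ℚ) := con 0ℚ) refl
  base-x : ∀ c → rat (x (base c)) ≡ ½ ℚ.* fromℤ (offset c)
  base-x black = refl
  base-x white = refl
  base-irr : ∀ c → irr (x (base c)) ≡ 0ℚ
  base-irr black = refl
  base-irr white = refl
  base-y : ∀ c → rat (y (base c)) ≡ 0ℚ
  base-y black = refl
  base-y white = refl
  base-y-irr : ∀ c → irr (y (base c)) ≡ 0ℚ
  base-y-irr black = refl
  base-y-irr white = refl

½*-injective : ∀ {i j} → ½ ℚ.* fromℤ i ≡ ½ ℚ.* fromℤ j → i ≡ j
½*-injective {i} {j} e = fromℤ-injective (trans (sym (double (fromℤ i)))
  (trans (cong (fromℤ (+ 2) ℚ.*_) e) (double (fromℤ j))))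
  where
  double : ∀ q → fromℤ (+ 2) ℚ.* (½ ℚ.* q) ≡ q
  double = solve 1 (λ q → con (fromℤ (+ 2)) :* (con ½ :* q) := q) refl

-- Tells the colours apart: doubled abscissae are 2 mod 3 at black sites and 0 mod 3 at white ones.
2≢3* : ∀ k → + 2 ≢ + 3 ℤ.* k
2≢3* k e = toWitnessFalse {a? = 3 ℕ∣.∣? 2} _
  (ℕ∣.divides ℤ.∣ k ∣ (trans (cong ℤ.∣_∣ (trans e (ℤₚ.*-comm (+ 3) k))) (ℤₚ.abs-* k (+ 3))))

sum-difference-injective : ∀ {i j i′ j′} → i ℤ.+ j ≡ i′ ℤ.+ j′ → i ℤ.- j ≡ i′ ℤ.- j′ → i ≡ i′ × j ≡ j′
sum-difference-injective {i} {j} {i′} {j′} e₊ e₋ =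
    ℤₚ.*-cancelˡ-≡ (+ 2) i i′ (trans (2i i j) (trans (cong₂ ℤ._+_ e₊ e₋) (sym (2i i′ j′))))
  , ℤₚ.*-cancelˡ-≡ (+ 2) j j′ (trans (2j i j) (trans (cong₂ ℤ._-_ e₊ e₋) (sym (2j i′ j′))))
  where
  2i : ∀ i j → + 2 ℤ.* i ≡ (i ℤ.+ j) ℤ.+ (i ℤ.- j)
  2i = solve-∀
  2j : ∀ i j → + 2 ℤ.* j ≡ (i ℤ.+ j) ℤ.- (i ℤ.- j)
  2j = solve-∀

-- The doubled abscissa mod 3 yields the colour, and then m + n; the ordinate yields m - n. Sum and
-- difference determine m and n.
site-injective : ∀ {c m n c′ m′ n′} → site c m n ≡ site c′ m′ n′ → c ≡ c′ × m ≡ m′ × n ≡ n′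
site-injective {c} {m} {n} {c′} {m′} {n′} e = colours c c′ eₓ
  where
  e′ = trans (sym (site-coordinates c m n)) (trans e (site-coordinates c′ m′ n′))
  eₓ : abscissa c m n ≡ abscissa c′ m′ n′
  eₓ = ½*-injective (cong (rat ∘ x) e′)
  e₋ : m ℤ.- n ≡ m′ ℤ.- n′
  e₋ = ½*-injective (cong (irr ∘ y) e′)

  isolate : ∀ s s′ → + 2 ℤ.+ + 3 ℤ.* s ≡ + 0 ℤ.+ + 3 ℤ.* s′ → + 2 ≡ + 3 ℤ.* (s′ ℤ.- s)
  isolate s s′ e = trans (shift s) (trans (cong (ℤ._- + 3 ℤ.* s) e) (factor s s′))
    where
    shift : ∀ s → + 2 ≡ (+ 2 ℤ.+ + 3 ℤ.* s) ℤ.- + 3 ℤ.* s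
    shift = solve-∀
    factor : ∀ s s′ → (+ 0 ℤ.+ + 3 ℤ.* s′) ℤ.- + 3 ℤ.* s ≡ + 3 ℤ.* (s′ ℤ.- s)
    factor = solve-∀

  e₊ : ∀ o → o ℤ.+ + 3 ℤ.* (m ℤ.+ n) ≡ o ℤ.+ + 3 ℤ.* (m′ ℤ.+ n′) → m ℤ.+ n ≡ m′ ℤ.+ n′
  e₊ o e = ℤₚ.*-cancelˡ-≡ (+ 3) _ _ (ℤ+.∙-cancelˡ o _ _ e)

  colours : ∀ c c′ → abscissa c m n ≡ abscissa c′ m′ n′ → c ≡ c′ × m ≡ m′ × n ≡ n′
  colours black black e = refl , sum-difference-injective (e₊ (+ 2) e) e₋
  colours white white e = refl , sum-difference-injective (e₊ (+ 0) e) e₋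
  colours black white e = contradiction (isolate (m ℤ.+ n) (m′ ℤ.+ n′) e) (2≢3* _)
  colours white black e = contradiction (isolate (m′ ℤ.+ n′) (m ℤ.+ n) (sym e)) (2≢3* _)

-- Unit distances and the three directions of edges.

δ₁ δ₂ : Fin 3 → ℤ
δ₁ 0F = + 0
δ₁ 1F = + 1
δ₁ 2F = + 0
δ₂ 0F = + 0
δ₂ 1F = + 0
δ₂ 2F = + 1

-- Translation by -(m v₁ + n v₂) reduces every distance computation to one that starts at black 0 0.
site--ᵥ : ∀ m n i j →
  site black m n -ᵥ site white (m ℤ.+ i) (n ℤ.+ j) ≡ site black 0ℤ 0ℤ -ᵥ site white i j
site--ᵥ m n i j = trans
  (cong₂ _-ᵥ_ (sym (trans (translation-site m n black 0ℤ 0ℤ)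
                 (cong₂ (site black) (ℤₚ.+-identityʳ m) (ℤₚ.+-identityʳ n))))
              (sym (translation-site m n white i j)))
  (t+p-[t+q] (m • v₁ +ᵥ n • v₂) (site black 0ℤ 0ℤ) (site white i j))

unit-distance : ∀ m n d →
  ‖ site black m n -ᵥ site white (m ℤ.+ δ₁ d) (n ℤ.+ δ₂ d) ‖² ≡ rational 1ℚ
unit-distance m n d = trans (cong ‖_‖² (site--ᵥ m n (δ₁ d) (δ₂ d))) (unit-base d)
  where
  unit-base : ∀ d → ‖ site black 0ℤ 0ℤ -ᵥ site white (δ₁ d) (δ₂ d) ‖² ≡ rational 1ℚ
  unit-base 0F = refl
  unit-base 1F = refl
  unit-base 2F = refl

-- The difference vector is ((2 - 3(i + j)) / 2 , -(i - j) √3 / 2). The factor 4 clears the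
-- denominators and moves the equation from ℚ to ℤ.
4‖-‖² : ∀ i j → fromℤ (+ 4) ℚ.* rat ‖ site black 0ℤ 0ℤ -ᵥ site white i j ‖² ≡
  fromℤ ((+ 2 ℤ.- + 3 ℤ.* (i ℤ.+ j)) ℤ.* (+ 2 ℤ.- + 3 ℤ.* (i ℤ.+ j)) ℤ.+ + 3 ℤ.* ((i ℤ.- j) ℤ.* (i ℤ.- j)))
4‖-‖² i j = begin
  fromℤ (+ 4) ℚ.* rat ‖ site black 0ℤ 0ℤ -ᵥ site white i j ‖²
    ≡⟨ cong (λ p → fromℤ (+ 4) ℚ.* rat ‖ site black 0ℤ 0ℤ -ᵥ p ‖²) (site-coordinates white i j) ⟩
  _
    ≡⟨ solve 2 (λ a d →
         con (fromℤ (+ 4)) :* (((con 1ℚ :- con ½ :* a) :* (con 1ℚ :- con ½ :* a) :+ con (fromℤ (+ 3)) :* ((con 0ℚ :- con 0ℚ) :* (con 0ℚ :- con 0ℚ)))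
           :+ ((con 0ℚ :- con 0ℚ) :* (con 0ℚ :- con 0ℚ) :+ con (fromℤ (+ 3)) :* ((con 0ℚ :- con ½ :* d) :* (con 0ℚ :- con ½ :* d))))
         := (con (fromℤ (+ 2)) :- a) :* (con (fromℤ (+ 2)) :- a) :+ con (fromℤ (+ 3)) :* (d :* d)) refl A D ⟩
  (fromℤ (+ 2) ℚ.- A) ℚ.* (fromℤ (+ 2) ℚ.- A) ℚ.+ fromℤ (+ 3) ℚ.* (D ℚ.* D)
    ≡⟨ cong₂ ℚ._+_ (trans (cong (λ q → q ℚ.* q) minus) (sym (fromℤ-* a a)))
         (trans (cong (fromℤ (+ 3) ℚ.*_) (sym (fromℤ-* d d))) (sym (fromℤ-* (+ 3) (d ℤ.* d)))) ⟩
  fromℤ (a ℤ.* a) ℚ.+ fromℤ (+ 3 ℤ.* (d ℤ.* d))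
    ≡⟨ fromℤ-+ (a ℤ.* a) (+ 3 ℤ.* (d ℤ.* d)) ⟨
  fromℤ (a ℤ.* a ℤ.+ + 3 ℤ.* (d ℤ.* d)) ∎
  where
  open ≡-Reasoning
  A = fromℤ (abscissa white i j)
  D = fromℤ (i ℤ.- j)
  a = + 2 ℤ.- + 3 ℤ.* (i ℤ.+ j)
  d = i ℤ.- j
  minus : fromℤ (+ 2) ℚ.- A ≡ fromℤ a
  minus = sym (trans (fromℤ-+ (+ 2) (ℤ.- (+ 3 ℤ.* (i ℤ.+ j)))) (cong (fromℤ (+ 2) ℚ.+_)
    (trans (fromℤ-neg (+ 3 ℤ.* (i ℤ.+ j)))
           (cong (λ k → ℚ.- fromℤ k) (sym (ℤₚ.+-identityˡ (+ 3 ℤ.* (i ℤ.+ j))))))))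

square-nonNegative : ∀ i → Σ[ k ∈ ℕ ] i ℤ.* i ≡ + k
square-nonNegative (+ k)    = k ℕ.* k , sym (ℤₚ.pos-* k k)
square-nonNegative -[1+ k ] = suc k ℕ.* suc k , refl

-- For s = i + j and d = i − j, three times the left-hand side is 4 (N − 1),
-- where N is the squared distance from black 0 0 to white i j.
ellipse : ∀ s d → s ℤ.* (+ 3 ℤ.* s ℤ.- + 4) ℤ.+ d ℤ.* d ≡ + 0 →
  (s ≡ + 0 × d ≡ + 0) ⊎ (s ≡ + 1 × d ≡ + 1) ⊎ (s ≡ + 1 × d ≡ -[1+ 0 ])
ellipse (+ 0) d e = inj₁ (refl , Sum.reduce (ℤₚ.i*j≡0⇒i≡0∨j≡0 d (trans (sym (ℤₚ.+-identityˡ _)) e)))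
ellipse (+ 1) (+ 0) ()
ellipse (+ 1) (+ 1) e = inj₂ (inj₁ (refl , refl))
ellipse (+ 1) ℤ.+[1+ suc d ] ()
ellipse (+ 1) -[1+ 0 ] e = inj₂ (inj₂ (refl , refl))
ellipse (+ 1) -[1+ suc d ] ()
-- For s = 2 + n the left-hand side expands to 4 + n (8 + 3 n) + d², and for s = -(1 + n) in the
-- next clause to 7 + n (10 + 3 n) + d². With d² written as a natural number, both are visibly
-- positive.
ellipse ℤ.+[1+ suc n ] d e with k , d²≡k ← square-nonNegative d = contradiction
  (trans (cong₂ (λ a b → + 4 ℤ.+ a ℤ.+ b) (ℤₚ.pos-* n _) (sym d²≡k))
  (trans (cong (λ a → + 4 ℤ.+ + n ℤ.* (+ 8 ℤ.+ a) ℤ.+ d ℤ.* d) (ℤₚ.pos-* 3 n))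
  (trans (expand (+ n) (d ℤ.* d)) e))) λ ()
  where
  expand : ∀ n k → + 4 ℤ.+ n ℤ.* (+ 8 ℤ.+ + 3 ℤ.* n) ℤ.+ k
    ≡ (+ 2 ℤ.+ n) ℤ.* (+ 3 ℤ.* (+ 2 ℤ.+ n) ℤ.- + 4) ℤ.+ k
  expand = solve-∀
ellipse s@(-[1+ n ]) d e with k , d²≡k ← square-nonNegative d = contradiction
  (trans (cong₂ (λ a b → + 7 ℤ.+ a ℤ.+ b) (ℤₚ.pos-* n _) (sym d²≡k))
  (trans (cong (λ a → + 7 ℤ.+ + n ℤ.* (+ 10 ℤ.+ a) ℤ.+ d ℤ.* d) (ℤₚ.pos-* 3 n))
  (trans (expand (+ n) (d ℤ.* d)) e))) λ ()
  where
  expand : ∀ n k → + 7 ℤ.+ n ℤ.* (+ 10 ℤ.+ + 3 ℤ.* n) ℤ.+ k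
    ≡ (ℤ.- (+ 1 ℤ.+ n)) ℤ.* (+ 3 ℤ.* (ℤ.- (+ 1 ℤ.+ n)) ℤ.- + 4) ℤ.+ k
  expand = solve-∀

-- In terms of s = i + j and d = i - j, the unit distance becomes the equation of `ellipse`. Its
-- solutions (0 , 0), (1 , 1) and (1 , -1) are the directions (i , j) = (0 , 0), (1 , 0) and (0 ,
-- 1).
unit-distance⁻¹ : ∀ m n m′ n′ → ‖ site black m n -ᵥ site white m′ n′ ‖² ≡ rational 1ℚ →
  Σ[ d ∈ Fin 3 ] m′ ≡ m ℤ.+ δ₁ d × n′ ≡ n ℤ.+ δ₂ d
unit-distance⁻¹ m n m′ n′ e = direction (ellipse (i ℤ.+ j) (i ℤ.- j)
  (ℤₚ.*-cancelˡ-≡ (+ 3) _ (+ 0) (trans (expand (i ℤ.+ j) (i ℤ.- j)) (cong (ℤ._- + 4) (sym integral)))))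
  where
  i = m′ ℤ.- m
  j = n′ ℤ.- n

  difference : ∀ a b → a ≡ b ℤ.+ (a ℤ.- b)
  difference = solve-∀

  e′ : ‖ site black 0ℤ 0ℤ -ᵥ site white i j ‖² ≡ rational 1ℚ
  e′ = trans (cong ‖_‖² (sym (site--ᵥ m n i j)))
    (trans (cong₂ (λ a b → ‖ site black m n -ᵥ site white a b ‖²) (sym (difference m′ m)) (sym (difference n′ n))) e)

  integral : + 4 ≡ (+ 2 ℤ.- + 3 ℤ.* (i ℤ.+ j)) ℤ.* (+ 2 ℤ.- + 3 ℤ.* (i ℤ.+ j)) ℤ.+ + 3 ℤ.* ((i ℤ.- j) ℤ.* (i ℤ.- j))
  integral = fromℤ-injective (trans (cong (λ z → fromℤ (+ 4) ℚ.* rat z) (sym e′)) (4‖-‖² i j))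

  expand : ∀ s d → + 3 ℤ.* (s ℤ.* (+ 3 ℤ.* s ℤ.- + 4) ℤ.+ d ℤ.* d)
    ≡ (+ 2 ℤ.- + 3 ℤ.* s) ℤ.* (+ 2 ℤ.- + 3 ℤ.* s) ℤ.+ + 3 ℤ.* (d ℤ.* d) ℤ.- + 4
  expand = solve-∀

  shift : ∀ {k l} → i ≡ k × j ≡ l → m′ ≡ m ℤ.+ k × n′ ≡ n ℤ.+ l
  shift (refl , refl) = difference m′ m , difference n′ n

  direction : _ → Σ[ d ∈ Fin 3 ] m′ ≡ m ℤ.+ δ₁ d × n′ ≡ n ℤ.+ δ₂ d
  direction (inj₁ (s , d))        = 0F , shift (sum-difference-injective {j′ = + 0} s d)
  direction (inj₂ (inj₁ (s , d))) = 1F , shift (sum-difference-injective {j′ = + 0} s d)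
  direction (inj₂ (inj₂ (s , d))) = 2F , shift (sum-difference-injective {i′ = + 0} s d)

-- Residues of integers mod k.

module Residue (k : ℕ) .{{_ : NonZero k}} where

  residue : ℤ → Fin k
  residue i = fromℕ< (ℤ÷.n%ℕd<d i k)

  private
    rep : ℤ → ℤ
    rep i = + toℕ (residue i)

  division : ∀ i → i ≡ (i ℤ./ℕ k) ℤ.* + k ℤ.+ + toℕ (residue i)
  division i = begin
    i                                          ≡⟨ ℤ÷.a≡a%ℕn+[a/ℕn]*n i k ⟩
    + (i ℤ.%ℕ k) ℤ.+ (i ℤ./ℕ k) ℤ.* + k        ≡⟨ ℤₚ.+-comm (+ (i ℤ.%ℕ k)) ((i ℤ./ℕ k) ℤ.* + k) ⟩
    (i ℤ./ℕ k) ℤ.* + k ℤ.+ + (i ℤ.%ℕ k)        ≡⟨ cong (λ r → (i ℤ./ℕ k) ℤ.* + k ℤ.+ + r) (toℕ-fromℕ< (ℤ÷.n%ℕd<d i k)) ⟨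
    (i ℤ./ℕ k) ℤ.* + k ℤ.+ + toℕ (residue i)   ∎
    where open ≡-Reasoning

  -- Both representatives lie below k, so q has to vanish: a positive q would make r at least k, and
  -- a negative one becomes positive when r and s are exchanged.
  representatives-unique : ∀ q (r s : Fin k) → + toℕ r ≡ q ℤ.* + k ℤ.+ + toℕ s → r ≡ s
  representatives-unique (+ 0) r s e = toℕ-injective (ℤₚ.+-injective e)
  representatives-unique ℤ.+[1+ q ] r s e = contradiction (toℕ<n r) (ℕₚ.≤⇒≯ (ℕₚ.≤-trans
    (ℕₚ.≤-trans (ℕₚ.m≤m+n k (q ℕ.* k)) (ℕₚ.m≤m+n _ (toℕ s)))
    (ℕₚ.≤-reflexive (ℤₚ.+-injective (sym (trans e (cong (ℤ._+ + toℕ s) (sym (ℤₚ.pos-* (suc q) k)))))))))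
  representatives-unique -[1+ q ] r s e = sym (representatives-unique ℤ.+[1+ q ] s r
    (trans (swap ℤ.+[1+ q ] (+ k) (+ toℕ s)) (cong (λ i → ℤ.+[1+ q ] ℤ.* + k ℤ.+ i) (sym e))))
    where
    swap : ∀ q k s → s ≡ q ℤ.* k ℤ.+ (ℤ.- q ℤ.* k ℤ.+ s)
    swap = solve-∀

  residue-periodic : ∀ q i → residue (q ℤ.* + k ℤ.+ i) ≡ residue i
  residue-periodic q i = representatives-unique (q ℤ.+ (i ℤ./ℕ k) ℤ.- (j ℤ./ℕ k)) (residue j) (residue i)
    (trans (isolate _ _ j (division j)) (trans (cong (λ h → (q ℤ.* + k ℤ.+ h) ℤ.- (j ℤ./ℕ k) ℤ.* + k) (division i))
      (collect q (i ℤ./ℕ k) (j ℤ./ℕ k) (+ k) (rep i))))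
    where
    j = q ℤ.* + k ℤ.+ i
    isolate : ∀ a r j → j ≡ a ℤ.+ r → r ≡ j ℤ.- a
    isolate a r _ refl = lemma a r
      where
      lemma : ∀ a r → r ≡ (a ℤ.+ r) ℤ.- a
      lemma = solve-∀
    collect : ∀ q a b k r → (q ℤ.* k ℤ.+ (a ℤ.* k ℤ.+ r)) ℤ.- b ℤ.* k ≡ (q ℤ.+ a ℤ.- b) ℤ.* k ℤ.+ r
    collect = solve-∀

  residue-toℕ : ∀ r → residue (+ toℕ r) ≡ r
  residue-toℕ r = sym (representatives-unique (+ toℕ r ℤ./ℕ k) r _ (division (+ toℕ r)))

  residue⁻¹ : ∀ i j → residue i ≡ residue j → ∃ λ q → j ≡ q ℤ.* + k ℤ.+ i
  residue⁻¹ i j e = (j ℤ./ℕ k) ℤ.- (i ℤ./ℕ k) , (begin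
    j                                        ≡⟨ division j ⟩
    (j ℤ./ℕ k) ℤ.* + k ℤ.+ rep j             ≡⟨ cong (λ r → (j ℤ./ℕ k) ℤ.* + k ℤ.+ + toℕ r) e ⟨
    (j ℤ./ℕ k) ℤ.* + k ℤ.+ rep i             ≡⟨ collect (j ℤ./ℕ k) (i ℤ./ℕ k) (+ k) (rep i) ⟩
    q ℤ.* + k ℤ.+ ((i ℤ./ℕ k) ℤ.* + k ℤ.+ rep i) ≡⟨ cong (λ h → q ℤ.* + k ℤ.+ h) (division i) ⟨
    q ℤ.* + k ℤ.+ i ∎)
    where
    open ≡-Reasoning
    q = (j ℤ./ℕ k) ℤ.- (i ℤ./ℕ k)
    collect : ∀ a b k r → a ℤ.* k ℤ.+ r ≡ (a ℤ.- b) ℤ.* k ℤ.+ (b ℤ.* k ℤ.+ r)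
    collect = solve-∀

  -- This and `residue-−` allow a class to be computed from a representative, so that `neighbour`
  -- and `reflect` can be defined on the finite set of cells.
  residue-+ : ∀ i j → residue (+ toℕ (residue i) ℤ.+ j) ≡ residue (i ℤ.+ j)
  residue-+ i j = sym (trans (cong residue (trans (cong (ℤ._+ j) (division i)) (ℤₚ.+-assoc ((i ℤ./ℕ k) ℤ.* + k) (rep i) j)))
    (residue-periodic (i ℤ./ℕ k) (rep i ℤ.+ j)))

  residue-− : ∀ j i → residue (j ℤ.- + toℕ (residue i)) ≡ residue (j ℤ.- i)
  residue-− j i = sym (trans (cong residue (trans (cong (λ h → j ℤ.- h) (division i)) (negate j (i ℤ./ℕ k) (+ k) (rep i))))
    (residue-periodic (ℤ.- (i ℤ./ℕ k)) (j ℤ.- rep i)))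
    where
    negate : ∀ j q k r → j ℤ.- (q ℤ.* k ℤ.+ r) ≡ ℤ.- q ℤ.* k ℤ.+ (j ℤ.- r)
    negate = solve-∀

-- The quotient of ℤ² by the lattice spanned by (k , 0) and (2 , 2).

Cell : ℕ → Set
Cell k = Fin k × Fin 2

Class : ℕ → Set
Class k = Colour × Cell k

module Cells (k : ℕ) .{{_ : NonZero k}} where
  open Residue k
  private module ℤ/2 = Residue 2

  cell : ℤ → ℤ → Cell k
  cell m n = residue (m ℤ.- n) , ℤ/2.residue n

  lift₁ lift₂ : Cell k → ℤ
  lift₁ (a , b) = + toℕ a ℤ.+ + toℕ b
  lift₂ (a , b) = + toℕ b

  cell-lift : ∀ x → cell (lift₁ x) (lift₂ x) ≡ x
  cell-lift (a , b) = cong₂ _,_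
    (trans (cong residue (cancel (+ toℕ a) (+ toℕ b))) (residue-toℕ a)) (ℤ/2.residue-toℕ b)
    where
    cancel : ∀ a b → (a ℤ.+ b) ℤ.- b ≡ a
    cancel = solve-∀

  cell-periodic : ∀ i j m n →
    cell ((i ℤ.* + k ℤ.+ j ℤ.* + 2) ℤ.+ m) (j ℤ.* + 2 ℤ.+ n) ≡ cell m n
  cell-periodic i j m n = cong₂ _,_
    (trans (cong residue (cancel (i ℤ.* + k) (j ℤ.* + 2) m n)) (residue-periodic i (m ℤ.- n)))
    (ℤ/2.residue-periodic j n)
    where
    cancel : ∀ a b m n → ((a ℤ.+ b) ℤ.+ m) ℤ.- (b ℤ.+ n) ≡ a ℤ.+ (m ℤ.- n)
    cancel = solve-∀

  cell⁻¹ : ∀ m n m′ n′ → cell m n ≡ cell m′ n′ → ∃₂ λ i j →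
    m′ ≡ (i ℤ.* + k ℤ.+ j ℤ.* + 2) ℤ.+ m × n′ ≡ j ℤ.* + 2 ℤ.+ n
  cell⁻¹ m n m′ n′ e
    with i , eᵢ ← residue⁻¹ (m ℤ.- n) (m′ ℤ.- n′) (cong proj₁ e)
       | j , eⱼ ← ℤ/2.residue⁻¹ n n′ (cong proj₂ e)
    = i , j , trans (split m′ n′) (trans (cong₂ ℤ._+_ eᵢ eⱼ) (collect (i ℤ.* + k) (j ℤ.* + 2) m n)) , eⱼ
    where
    split : ∀ m n → m ≡ (m ℤ.- n) ℤ.+ n
    split = solve-∀
    collect : ∀ a b m n → (a ℤ.+ (m ℤ.- n)) ℤ.+ (b ℤ.+ n) ≡ (a ℤ.+ b) ℤ.+ m
    collect = solve-∀

  -- In the coordinates m - n and n of a cell, a step by (δ₁ , δ₂) becomes a step by (δ₁ - δ₂ , δ₂).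
  neighbour : Cell k → Fin 3 → Cell k
  neighbour (a , b) d = residue (+ toℕ a ℤ.+ (δ₁ d ℤ.- δ₂ d)) , ℤ/2.residue (+ toℕ b ℤ.+ δ₂ d)

  neighbour-cell : ∀ m n d → neighbour (cell m n) d ≡ cell (m ℤ.+ δ₁ d) (n ℤ.+ δ₂ d)
  neighbour-cell m n d = cong₂ _,_
    (trans (residue-+ (m ℤ.- n) (δ₁ d ℤ.- δ₂ d)) (cong residue (regroup m n (δ₁ d) (δ₂ d))))
    (ℤ/2.residue-+ n (δ₂ d))
    where
    regroup : ∀ m n a b → (m ℤ.- n) ℤ.+ (a ℤ.- b) ≡ (m ℤ.+ a) ℤ.- (n ℤ.+ b)
    regroup = solve-∀

  -- The map induced by (m , n) ↦ (-1 - m , -1 - n): the constants cancel in m - n, which is merely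
  -- negated.
  reflect : Cell k → Cell k
  reflect (a , b) = residue (0ℤ ℤ.- + toℕ a) , ℤ/2.residue (ℤ.-1ℤ ℤ.- + toℕ b)

  reflect-cell : ∀ m n → reflect (cell m n) ≡ cell (ℤ.-1ℤ ℤ.- m) (ℤ.-1ℤ ℤ.- n)
  reflect-cell m n = cong₂ _,_
    (trans (residue-− 0ℤ (m ℤ.- n)) (cong residue (regroup m n)))
    (ℤ/2.residue-− ℤ.-1ℤ n)
    where
    regroup : ∀ m n → 0ℤ ℤ.- (m ℤ.- n) ≡ (ℤ.-1ℤ ℤ.- m) ℤ.- (ℤ.-1ℤ ℤ.- n)
    regroup = solve-∀

-- Quotients of the honeycomb described by complete orbit invariants.

module Orbits (k : ℕ) .{{_ : NonZero k}} where
  open Cells k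

  class : Colour → ℤ → ℤ → Class k
  class c m n = c , cell m n

  -- Besides invariance of κ, this contains what makes g act on the honeycomb: `image` takes
  -- vertices to vertices, and since `recolour` is injective, the ends of an edge keep different
  -- colours.
  record Respects {A : Set} (κ : Class k → A) (g : Isometry) : Set where
    field
      recolour  : Colour → Colour
      injective : Injective _≡_ _≡_ recolour
      image     : ∀ c m n → ∃₂ λ m′ n′ →
        to g (site c m n) ≡ site (recolour c) m′ n′ × κ (class c m n) ≡ κ (class (recolour c) m′ n′)

  -- κ (class c m n) is a complete invariant of the H-orbit of site c m n.
  record Classifies {A : Set} (κ : Class k → A) (H : Subgroup isometries) : Set where
    field
      κ⁻¹        : A → Class k
      κ-κ⁻¹      : ∀ a → κ (κ⁻¹ a) ≡ a
      respects   : ∀ {g} → Member H g → Respects κ g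
      transitive : ∀ c m n c′ m′ n′ → κ (class c m n) ≡ κ (class c′ m′ n′) →
        Σ[ g ∈ Isometry ] Member H g × to g (site c m n) ≡ site c′ m′ n′

  -- The finite data needed for an isomorphism: the values of κ correspond to the vertices of Γ,
  -- `edge` sends every honeycomb edge to an edge of Γ, and `edge⁻¹` finds a honeycomb edge above
  -- each edge of Γ, read in one of its two orientations.
  record Labelling {A : Set} (κ : Class k → A) (Γ : Graph) : Set where
    open Graph Γ using (Vertex; _≈_; Adj)
    field
      label           : A → Vertex
      label-injective : ∀ {x y} → label x ≈ label y → x ≡ y
      index           : Vertex → A
      label-index     : ∀ v → label (index v) ≈ v

    Joined : Vertex → Vertex → Cell k → Fin 3 → Set
    Joined u v x d = u ≈ label (κ (black , x)) × v ≈ label (κ (white , neighbour x d))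

    field
      edge   : ∀ x d → Adj (label (κ (black , x))) (label (κ (white , neighbour x d)))
      edge⁻¹ : ∀ u v → Adj u v → ∃₂ λ x d → Joined u v x d ⊎ Joined v u x d

  module _ {A : Set} {κ : Class k → A} {H : Subgroup isometries} (κ-classifies : Classifies κ H) where
    open Classifies κ-classifies
    open Respects

    private
      Site : Colour → Point → Set
      Site c p = ∃₂ λ m n → p ≡ site c m n

      G = asGroup H

      site∈ : ∀ c {p} → Site c p → p ∈ B ∪ W
      site∈ black (m , n , refl) = inj₁ (m , n , refl)
      site∈ white (m , n , refl) = inj₂ (m , n , refl)

      coloured : ∀ {p} → p ∈ B ∪ W → Σ[ c ∈ Colour ] Site c p
      coloured (inj₁ b) = black , b
      coloured (inj₂ w) = white , w

      image-site : ∀ {g} (g∈H : Member H g) c {p} → Site c p → Site (recolour (respects g∈H) c) (to g p)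
      image-site {g} g∈H c (m , n , p≡) =
        let m′ , n′ , e , _ = image (respects g∈H) c m n in m′ , n′ , trans (cong (to g) p≡) e

      infixr 7 _·_
      _·_ : Group.Carrier G → HoneycombVertex → HoneycombVertex
      (g , g∈H) · vertex p p∈ = let c , p∈c = coloured p∈ in
        vertex (to g p) (site∈ (recolour (respects g∈H) c) (image-site g∈H c p∈c))

      -- `Edge` lists the black end first, so an edge must be reversed when an isometry exchanges
      -- the colours.
      oriented : ∀ c c′ {p q} → c ≢ c′ → Site c p → Site c′ q → ‖ p -ᵥ q ‖² ≡ rational 1ℚ → Edge p q ⊎ Edge q p
      oriented black black c≢c′ _ _ _ = contradiction refl c≢c′
      oriented white white c≢c′ _ _ _ = contradiction refl c≢c′
      oriented black white _ p∈ q∈ e = inj₁ (p∈ , q∈ , e)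
      oriented white black {p} {q} _ p∈ q∈ e = inj₂ (q∈ , p∈ , trans (‖-‖²-swap q p) e)

      image-edge : ∀ {g} → Member H g → ∀ {b w} → Edge b w → Edge (to g b) (to g w) ⊎ Edge (to g w) (to g b)
      image-edge {g} g∈H (b∈ , w∈ , e) = oriented _ _
        (λ eq → contradiction (injective (respects g∈H) eq) λ ())
        (image-site g∈H black b∈) (image-site g∈H white w∈) (trans (isometric g _ _) e)

      image-adj : ∀ g u v → Graph.Adj 𝓛 u v → Graph.Adj 𝓛 (g · u) (g · v)
      image-adj (g , g∈H) u v (inj₁ e) = image-edge g∈H e
      image-adj (g , g∈H) u v (inj₂ e) = Sum.swap (image-edge g∈H e)

    honeycombAction : HoneycombAction H
    honeycombAction = record
      { action = record
        { _·_       = _·_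
        ; ·-cong    = λ {g} {h} {u} {v} g≈h u≈v → trans (cong (to (proj₁ g)) u≈v) (g≈h (point v))
        ; ε-action  = λ _ → refl
        ; ∙-action  = λ _ _ _ → refl
        -- The converse implication is the forward one for g⁻¹, followed by cancellation of g⁻¹
        -- against g.
        ; adjacency = λ g u v → mk⇔ (image-adj g u v) λ e →
            Adj-resp₂ (g ⁻¹ · g · u) (g ⁻¹ · g · v) u v
              (strictlyInverseʳ (proj₁ g) (point u)) (strictlyInverseʳ (proj₁ g) (point v))
              (image-adj (g ⁻¹) (g · u) (g · v) e)
        }
      ; agrees = λ _ _ → refl
      }
      where
      open Group G using (_⁻¹)

      Adj-resp₂ : ∀ u v u′ v′ → point u ≡ point u′ → point v ≡ point v′ →
        Graph.Adj 𝓛 u v → Graph.Adj 𝓛 u′ v′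
      Adj-resp₂ u v u′ v′ eᵤ eᵥ = proj₁ (Graph.Adj-resp 𝓛) {u′} {v} {v′} eᵥ ∘ proj₂ (Graph.Adj-resp 𝓛) {v} {u} {u′} eᵤ

    private
      𝓛/H : Graph
      𝓛/H = 𝓛 / HoneycombAction.action honeycombAction

      module 𝓛/H = Graph 𝓛/H

      invariant : ∀ {p} → p ∈ B ∪ W → A
      invariant (inj₁ (m , n , _)) = κ (class black m n)
      invariant (inj₂ (m , n , _)) = κ (class white m n)

      κ-cong : ∀ {c m n c′ m′ n′} → c ≡ c′ × m ≡ m′ × n ≡ n′ → κ (class c m n) ≡ κ (class c′ m′ n′)
      κ-cong (refl , refl , refl) = refl

      -- `invariant` reads the coordinates off the witness stored in a vertex. By `site-injective`
      -- any other coordinates of the same point give the same value.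
      invariant-site : ∀ {p} (p∈ : p ∈ B ∪ W) c m n → p ≡ site c m n → invariant p∈ ≡ κ (class c m n)
      invariant-site (inj₁ (m , n , e)) c′ m′ n′ e′ =
        κ-cong (site-injective {black} {m} {n} {c′} {m′} {n′} (trans (sym e) e′))
      invariant-site (inj₂ (m , n , e)) c′ m′ n′ e′ =
        κ-cong (site-injective {white} {m} {n} {c′} {m′} {n′} (trans (sym e) e′))

      orbit-invariant : ∀ u v → u 𝓛/H.≈ v → invariant (isVertex u) ≡ invariant (isVertex v)
      orbit-invariant (vertex p p∈) (vertex q q∈) ((g , g∈H) , gp≡q) = go (coloured p∈)
        where
        go : (Σ[ c ∈ Colour ] Site c p) → invariant p∈ ≡ invariant q∈
        go (c , m , n , p≡) = let m′ , n′ , e , κ≡ = image (respects g∈H) c m n in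
          trans (invariant-site p∈ c m n p≡)
            (trans κ≡ (sym (invariant-site q∈ (recolour (respects g∈H) c) m′ n′ (trans (sym gp≡q) (trans (cong (to g) p≡) e)))))

      invariant-orbit : ∀ u v → invariant (isVertex u) ≡ invariant (isVertex v) → u 𝓛/H.≈ v
      invariant-orbit (vertex p p∈) (vertex q q∈) e = go (coloured p∈) (coloured q∈)
        where
        go : (Σ[ c ∈ Colour ] Site c p) → (Σ[ c ∈ Colour ] Site c q) →
          Σ[ g ∈ Group.Carrier G ] to (proj₁ g) p ≡ q
        go (c , m , n , p≡) (c′ , m′ , n′ , q≡) =
          let g , g∈H , e′ = transitive c m n c′ m′ n′
                (trans (sym (invariant-site p∈ c m n p≡)) (trans e (invariant-site q∈ c′ m′ n′ q≡)))
          in (g , g∈H) , trans (cong (to g) p≡) (trans e′ (sym q≡))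

      siteVertex : Colour → ℤ → ℤ → HoneycombVertex
      siteVertex c m n = vertex (site c m n) (site∈ c (m , n , refl))

      invariant-siteVertex : ∀ c m n → invariant (isVertex (siteVertex c m n)) ≡ κ (class c m n)
      invariant-siteVertex c m n = invariant-site (site∈ c (m , n , refl)) c m n refl

      representative : Class k → HoneycombVertex
      representative (c , x) = siteVertex c (lift₁ x) (lift₂ x)

      invariant-representative : ∀ s → invariant (isVertex (representative s)) ≡ κ s
      invariant-representative (c , x) = trans (invariant-siteVertex c (lift₁ x) (lift₂ x)) (cong (λ y → κ (c , y)) (cell-lift x))

    module _ {Γ : Graph} (labelling : Labelling κ Γ) where
      open Labelling labelling
      private
        module Γ = Graph Γ

        vertexOf : Γ.Vertex → HoneycombVertex
        vertexOf u = representative (κ⁻¹ (index u))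

        invariant-vertexOf : ∀ u → invariant (isVertex (vertexOf u)) ≡ index u
        invariant-vertexOf u = trans (invariant-representative (κ⁻¹ (index u))) (κ-κ⁻¹ (index u))

        labelOf : HoneycombVertex → Γ.Vertex
        labelOf v = label (invariant (isVertex v))

        label-cong : ∀ {x y} → x ≡ y → label x Γ.≈ label y
        label-cong refl = Γ.refl

        -- Injectivity of `label` makes `index` its inverse, and hence compatible with the equality
        -- of Γ.
        index-label : ∀ {u} {a} → u Γ.≈ label a → index u ≡ a
        index-label u≈ = label-injective (Γ.trans (label-index _) u≈)

        labelOf-vertexOf : ∀ u v → v 𝓛/H.≈ vertexOf u → labelOf v Γ.≈ u
        labelOf-vertexOf u v e = Γ.trans
          (label-cong (trans (orbit-invariant v (vertexOf u) e) (invariant-vertexOf u))) (label-index u)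

        label-edge : ∀ m n {m′ n′} → (Σ[ d ∈ Fin 3 ] m′ ≡ m ℤ.+ δ₁ d × n′ ≡ n ℤ.+ δ₂ d) →
          Γ.Adj (label (κ (class black m n))) (label (κ (class white m′ n′)))
        label-edge m n (d , refl , refl) = proj₁ Γ.Adj-resp
          (label-cong (cong (λ y → κ (white , y)) (neighbour-cell m n d))) (edge (cell m n) d)

        labelOf-edge : ∀ {p q} (p∈ : p ∈ B ∪ W) (q∈ : q ∈ B ∪ W) → Edge p q →
          Γ.Adj (label (invariant p∈)) (label (invariant q∈))
        labelOf-edge p∈ q∈ ((m , n , p≡) , (m′ , n′ , q≡) , e) =
          proj₁ Γ.Adj-resp (label-cong (sym (invariant-site q∈ white m′ n′ q≡)))
            (proj₂ Γ.Adj-resp (label-cong (sym (invariant-site p∈ black m n p≡)))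
              (label-edge m n (unit-distance⁻¹ m n m′ n′
                (trans (cong₂ (λ p q → ‖ p -ᵥ q ‖²) (sym p≡) (sym q≡)) e))))

        labelOf-adj : ∀ u v → Graph.Adj 𝓛 u v → Γ.Adj (labelOf u) (labelOf v)
        labelOf-adj u v (inj₁ e) = labelOf-edge (isVertex u) (isVertex v) e
        labelOf-adj u v (inj₂ e) = Γ.Adj-sym (labelOf-edge (isVertex v) (isVertex u) e)

        -- The chosen representatives of the two orbits need not be adjacent themselves. Instead,
        -- the black site lifting x and its neighbour in direction d lie in these orbits and form an
        -- edge.
        joined-adj : ∀ u v x d → Joined u v x d → 𝓛/H.Adj (vertexOf u) (vertexOf v)
        joined-adj u v x d (u≈ , v≈) =
            siteVertex black m n , siteVertex white m′ n′
          , invariant-orbit (vertexOf u) (siteVertex black m n) (trans (invariant-vertexOf u) (trans (index-label u≈)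
              (sym (invariant-representative (black , x)))))
          , invariant-orbit (vertexOf v) (siteVertex white m′ n′) (trans (invariant-vertexOf v) (trans (index-label v≈)
              (sym (trans (invariant-siteVertex white m′ n′) (cong (λ y → κ (white , y))
                (trans (sym (neighbour-cell m n d)) (cong (λ y → neighbour y d) (cell-lift x))))))))
          , inj₁ ((m , n , refl) , (m′ , n′ , refl) , unit-distance m n d)
          where
          m = lift₁ x
          n = lift₂ x
          m′ = m ℤ.+ δ₁ d
          n′ = n ℤ.+ δ₂ d

      -- Vertices of Γ and orbits are matched through A, by `index` on one side and `invariant` on
      -- the other.
      quotient≅ : Γ ≅ 𝓛/H
      quotient≅ = record
        { bijection = record
          { to        = vertexOf
          ; from      = labelOf
          ; to-cong   = λ {u} {v} u≈v → invariant-orbit (vertexOf u) (vertexOf v) (trans (invariant-vertexOf u)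
              (trans (index-label (Γ.trans u≈v (Γ.sym (label-index v)))) (sym (invariant-vertexOf v))))
          ; from-cong = λ {u} {v} u∼v → label-cong (orbit-invariant u v u∼v)
          ; inverse   = (λ {v} {u} u≈ → invariant-orbit (vertexOf u) v (trans (invariant-vertexOf u) (index-label u≈)))
                      , (λ {u} {v} → labelOf-vertexOf u v)
          }
        ; adjacency = λ u v → mk⇔ (adj u v) (adj⁻¹ u v)
        }
        where
        adj : ∀ u v → Γ.Adj u v → 𝓛/H.Adj (vertexOf u) (vertexOf v)
        adj u v e with edge⁻¹ u v e
        ... | x , d , inj₁ j = joined-adj u v x d j
        ... | x , d , inj₂ j = 𝓛/H.Adj-sym {vertexOf v} {vertexOf u} (joined-adj v u x d j)

        adj⁻¹ : ∀ u v → 𝓛/H.Adj (vertexOf u) (vertexOf v) → Γ.Adj u v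
        adj⁻¹ u v (u′ , v′ , u∼u′ , v∼v′ , e) =
          proj₁ Γ.Adj-resp (labelOf-vertexOf v v′ (𝓛/H.sym {vertexOf v} {v′} v∼v′))
            (proj₂ Γ.Adj-resp (labelOf-vertexOf u u′ (𝓛/H.sym {vertexOf u} {u′} u∼u′)) (labelOf-adj u′ v′ e))

-- Bases of the two lattices.

-- ℤu + ℤv is the lattice with basis k v₁ , 2(v₁ + v₂).
record Basis (k : ℕ) (u v : Point) : Set where
  field
    coordinates   : ∀ p q → ∃₂ λ i j → p • u +ᵥ q • v ≡ (i ℤ.* + k ℤ.+ j ℤ.* + 2) • v₁ +ᵥ (j ℤ.* + 2) • v₂
    coordinates⁻¹ : ∀ i j → ∃₂ λ p q → p • u +ᵥ q • v ≡ (i ℤ.* + k ℤ.+ j ℤ.* + 2) • v₁ +ᵥ (j ℤ.* + 2) • v₂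

•-combine₂ : ∀ p q a b c d → p • (a • v₁ +ᵥ b • v₂) +ᵥ q • (c • v₁ +ᵥ d • v₂)
                           ≡ (p ℤ.* a ℤ.+ q ℤ.* c) • v₁ +ᵥ (p ℤ.* b ℤ.+ q ℤ.* d) • v₂
•-combine₂ p q a b c d = trans (cong₂ _+ᵥ_ (•-combine p a b) (•-combine q c d))
  (combine-+ (p ℤ.* a) (p ℤ.* b) (q ℤ.* c) (q ℤ.* d) v₁ v₂)

combine-cong : ∀ {m n m′ n′} → m ≡ m′ → n ≡ n′ → m • v₁ +ᵥ n • v₂ ≡ m′ • v₁ +ᵥ n′ • v₂
combine-cong refl refl = refl

-- p (2v₁) + q (2v₂) = (p - q) (2v₁) + q (2v₁ + 2v₂).
Q-basis : Basis 2 (+ 2 • v₁) (+ 2 • v₂)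
Q-basis = record
  { coordinates   = λ p q → p ℤ.- q , q , span p q (p ℤ.- q) q (eq₁ p q) (eq₂ p q)
  ; coordinates⁻¹ = λ i j → i ℤ.+ j , j , span (i ℤ.+ j) j i j (eq₃ i j) (eq₂ (i ℤ.+ j) j)
  }
  where
  span : ∀ p q i j → p ℤ.* + 2 ℤ.+ q ℤ.* + 0 ≡ i ℤ.* + 2 ℤ.+ j ℤ.* + 2 → p ℤ.* + 0 ℤ.+ q ℤ.* + 2 ≡ j ℤ.* + 2 →
    p • (+ 2 • v₁) +ᵥ q • (+ 2 • v₂) ≡ (i ℤ.* + 2 ℤ.+ j ℤ.* + 2) • v₁ +ᵥ (j ℤ.* + 2) • v₂
  -- The spanning vectors are closed terms, so 2v₁ and 2v₁ + 0v₂ agree by evaluation.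
  span p q i j e e′ = trans (•-combine₂ p q (+ 2) (+ 0) (+ 0) (+ 2)) (combine-cong e e′)
  eq₁ : ∀ p q → p ℤ.* + 2 ℤ.+ q ℤ.* + 0 ≡ (p ℤ.- q) ℤ.* + 2 ℤ.+ q ℤ.* + 2
  eq₁ = solve-∀
  eq₂ : ∀ p q → p ℤ.* + 0 ℤ.+ q ℤ.* + 2 ≡ q ℤ.* + 2
  eq₂ = solve-∀
  eq₃ : ∀ i j → (i ℤ.+ j) ℤ.* + 2 ℤ.+ j ℤ.* + 0 ≡ i ℤ.* + 2 ℤ.+ j ℤ.* + 2
  eq₃ = solve-∀

-- The first generator is itself a basis vector, and 4v₁ - 2v₂ = 6v₁ - 2(v₁ + v₂).
X₃-basis : Basis 6 (+ 2 • v₁ +ᵥ + 2 • v₂) (+ 4 • v₁ -ᵥ + 2 • v₂)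
X₃-basis = record
  { coordinates   = λ p q → q , p ℤ.- q , span p q q (p ℤ.- q) (eq₁ p q) (eq₂ p q)
  ; coordinates⁻¹ = λ i j → i ℤ.+ j , i , span (i ℤ.+ j) i i j (eq₃ i j) (eq₄ i j)
  }
  where
  span : ∀ p q i j → p ℤ.* + 2 ℤ.+ q ℤ.* + 4 ≡ i ℤ.* + 6 ℤ.+ j ℤ.* + 2 → p ℤ.* + 2 ℤ.+ q ℤ.* -[1+ 1 ] ≡ j ℤ.* + 2 →
    p • (+ 2 • v₁ +ᵥ + 2 • v₂) +ᵥ q • (+ 4 • v₁ -ᵥ + 2 • v₂) ≡ (i ℤ.* + 6 ℤ.+ j ℤ.* + 2) • v₁ +ᵥ (j ℤ.* + 2) • v₂
  span p q i j e e′ = trans (•-combine₂ p q (+ 2) (+ 2) (+ 4) -[1+ 1 ]) (combine-cong e e′)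
  eq₁ : ∀ p q → p ℤ.* + 2 ℤ.+ q ℤ.* + 4 ≡ q ℤ.* + 6 ℤ.+ (p ℤ.- q) ℤ.* + 2
  eq₁ = solve-∀
  eq₂ : ∀ p q → p ℤ.* + 2 ℤ.+ q ℤ.* -[1+ 1 ] ≡ (p ℤ.- q) ℤ.* + 2
  eq₂ = solve-∀
  eq₃ : ∀ i j → (i ℤ.+ j) ℤ.* + 2 ℤ.+ i ℤ.* + 4 ≡ i ℤ.* + 6 ℤ.+ j ℤ.* + 2
  eq₃ = solve-∀
  eq₄ : ∀ i j → (i ℤ.+ j) ℤ.* + 2 ℤ.+ i ℤ.* -[1+ 1 ] ≡ j ℤ.* + 2
  eq₄ = solve-∀

-- Orbits of a lattice and of its extension by the half-turn.

opposite-injective : Injective _≡_ _≡_ opposite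
opposite-injective {black} {black} _ = refl
opposite-injective {white} {white} _ = refl

module Lattice {k : ℕ} .{{_ : NonZero k}} {u v : Point} (basis : Basis k u v) where
  open Cells k
  open Orbits k
  open Basis basis

  Λ : Subgroup isometries
  Λ = translations u v

  -- A lattice translation preserves the class itself, hence every function of it; this covers both
  -- `id` and `fold`.
  Λ-respects : ∀ {A : Set} (κ : Class k → A) {g} → Member Λ g → Respects κ g
  Λ-respects κ {g} (p , q , e) = record
    { recolour  = id
    ; injective = id
    ; image     = λ c m n →
        let i , j , e′ = coordinates p q in
          (i ℤ.* + k ℤ.+ j ℤ.* + 2) ℤ.+ m , j ℤ.* + 2 ℤ.+ n
        , trans (e (site c m n)) (trans (cong (λ t → to (translation t) (site c m n)) e′)
            (translation-site (i ℤ.* + k ℤ.+ j ℤ.* + 2) (j ℤ.* + 2) c m n))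
        , cong (λ x → κ (c , x)) (sym (cell-periodic i j m n))
    }

  Λ-transitive : ∀ c m n m′ n′ → cell m n ≡ cell m′ n′ →
    Σ[ g ∈ Isometry ] Member Λ g × to g (site c m n) ≡ site c m′ n′
  Λ-transitive c m n m′ n′ e =
    let i , j , eₘ , eₙ = cell⁻¹ m n m′ n′ e
        p , q , e′ = coordinates⁻¹ i j
    in translation (p • u +ᵥ q • v) , (p , q , λ _ → refl) ,
       trans (cong (λ t → to (translation t) (site c m n)) e′)
         (trans (translation-site (i ℤ.* + k ℤ.+ j ℤ.* + 2) (j ℤ.* + 2) c m n)
           (cong₂ (site c) (sym eₘ) (sym eₙ)))

  Λ-classifies : Classifies id Λ
  Λ-classifies = record
    { κ⁻¹        = id
    ; κ-κ⁻¹      = λ _ → refl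
    ; respects   = Λ-respects id
    ; transitive = transitive
    }
    where
    transitive : ∀ c m n c′ m′ n′ → class c m n ≡ class c′ m′ n′ →
      Σ[ g ∈ Isometry ] Member Λ g × to g (site c m n) ≡ site c′ m′ n′
    transitive c m n c′ m′ n′ e = recoloured (cong proj₁ e) (Λ-transitive c m n m′ n′ (cong proj₂ e))
      where
      recoloured : c ≡ c′ → (Σ[ g ∈ Isometry ] Member Λ g × to g (site c m n) ≡ site c m′ n′) →
        Σ[ g ∈ Isometry ] Member Λ g × to g (site c m n) ≡ site c′ m′ n′
      recoloured refl t = t

  G : Subgroup isometries
  G = Λ ⋊halfTurn hexagonCentre

  R : Isometry
  R = halfTurn hexagonCentre

  -- The half-turn exchanges the colours, so the white class of a pair represents it.
  fold : Class k → Cell k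
  fold (black , x) = reflect x
  fold (white , x) = x

  reflect-reflect : ∀ m n → reflect (reflect (cell m n)) ≡ cell m n
  reflect-reflect m n = trans (cong reflect (reflect-cell m n))
    (trans (reflect-cell (ℤ.-1ℤ ℤ.- m) (ℤ.-1ℤ ℤ.- n)) (cong₂ cell (involutive m) (involutive n)))
    where
    involutive : ∀ i → ℤ.-1ℤ ℤ.- (ℤ.-1ℤ ℤ.- i) ≡ i
    involutive = solve-∀

  fold-opposite : ∀ c m n → fold (class (opposite c) (ℤ.-1ℤ ℤ.- m) (ℤ.-1ℤ ℤ.- n)) ≡ fold (class c m n)
  fold-opposite black m n = sym (reflect-cell m n)
  fold-opposite white m n = trans (cong reflect (sym (reflect-cell m n))) (reflect-reflect m n)

  R-respects : ∀ {g} → (∀ p → to g p ≡ to R p) → Respects fold g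
  R-respects e = record
    { recolour  = opposite
    ; injective = opposite-injective
    ; image     = λ c m n → ℤ.-1ℤ ℤ.- m , ℤ.-1ℤ ℤ.- n
        , trans (e (site c m n)) (halfTurn-site c m n) , sym (fold-opposite c m n)
    }

  ∘-respects : ∀ {A : Set} {κ : Class k → A} g h → Respects κ g → Respects κ h → Respects κ (g I.∙ h)
  ∘-respects g h ρ σ = record
    { recolour  = ρ.recolour ∘ σ.recolour
    ; injective = σ.injective ∘ ρ.injective
    ; image     = λ c m n →
        let m′ , n′ , e , κ≡ = σ.image c m n
            m″ , n″ , e′ , κ≡′ = ρ.image (σ.recolour c) m′ n′
        in m″ , n″ , trans (cong (to g) e) e′ , trans κ≡ κ≡′
    }
    where
    module ρ = Respects ρ
    module σ = Respects σ

  respects-resp : ∀ {A : Set} {κ : Class k → A} g h → g I.≈ h → Respects κ g → Respects κ h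
  respects-resp g h g≈h ρ = record
    { recolour  = recolour
    ; injective = injective
    ; image     = λ c m n → let m′ , n′ , e , κ≡ = image c m n in m′ , n′ , trans (sym (g≈h (site c m n))) e , κ≡
    }
    where open Respects ρ

  -- `Respects` speaks of images and not of preimages, so the induction over generated elements
  -- treats an element together with its inverse.
  G-respects : ∀ {g} → Member G g → Respects fold g × Respects fold (g I.⁻¹)
  G-respects (generator {g} (inj₁ g∈Λ)) = Λ-respects fold g∈Λ , Λ-respects fold (⁻¹-closed Λ {g} g∈Λ)
  -- `halfTurn` uses the same map in both directions, so R is its own inverse by definition.
  G-respects (generator {g} (inj₂ e)) = R-respects e , R-respects (I.⁻¹-cong {g} {R} e)
  G-respects (resp {g} {h} g≈h g∈) = let ρ , ρ′ = G-respects g∈ in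
    respects-resp g h g≈h ρ , respects-resp (g I.⁻¹) (h I.⁻¹) (I.⁻¹-cong {g} {h} g≈h) ρ′
  G-respects unit = let ρ = Λ-respects fold (Subgroup.ε-closed Λ) in
    ρ , respects-resp I.ε (I.ε I.⁻¹) (λ _ → refl) ρ
  G-respects (product {g} {h} g∈ h∈) = let ρ , ρ′ = G-respects g∈ ; σ , σ′ = G-respects h∈ in
    ∘-respects g h ρ σ ,
    respects-resp ((h I.⁻¹) I.∙ (g I.⁻¹)) ((g I.∙ h) I.⁻¹) (λ _ → refl) (∘-respects (h I.⁻¹) (g I.⁻¹) σ′ ρ′)
  G-respects (inverse {g} g∈) = let ρ , ρ′ = G-respects g∈ in
    ρ′ , respects-resp g ((g I.⁻¹) I.⁻¹) (λ _ → refl) ρ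

  G-classifies : Classifies fold G
  G-classifies = record
    { κ⁻¹        = white ,_
    ; κ-κ⁻¹      = λ _ → refl
    ; respects   = proj₁ ∘ G-respects
    ; transitive = transitive
    }
    where
    Transports : Colour → ℤ → ℤ → Colour → ℤ → ℤ → Set
    Transports c m n c′ m′ n′ = Σ[ g ∈ Isometry ] Member G g × to g (site c m n) ≡ site c′ m′ n′

    R∈G : Member G R
    R∈G = generator {g = R} (inj₂ λ _ → refl)

    translate : ∀ c m n m′ n′ → cell m n ≡ cell m′ n′ → Transports c m n c m′ n′
    translate c m n m′ n′ e = let g , g∈Λ , e′ = Λ-transitive c m n m′ n′ e in g , generator {g = g} (inj₁ g∈Λ) , e′

    turn : ∀ c m n m′ n′ → cell (ℤ.-1ℤ ℤ.- m) (ℤ.-1ℤ ℤ.- n) ≡ cell m′ n′ → Transports c m n (opposite c) m′ n′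
    turn c m n m′ n′ e =
      let g , g∈G , e′ = translate (opposite c) (ℤ.-1ℤ ℤ.- m) (ℤ.-1ℤ ℤ.- n) m′ n′ e in
      g I.∙ R , product {g = g} {h = R} g∈G R∈G , trans (cong (to g) (halfTurn-site c m n)) e′

    -- For equal colours a translation suffices, `reflect` being cancelled by a second application.
    -- For different colours the half-turn comes first and a translation after it.
    transitive : ∀ c m n c′ m′ n′ → fold (class c m n) ≡ fold (class c′ m′ n′) → Transports c m n c′ m′ n′
    transitive white m n white m′ n′ e = translate white m n m′ n′ e
    transitive black m n black m′ n′ e = translate black m n m′ n′
      (trans (sym (reflect-reflect m n)) (trans (cong reflect e) (reflect-reflect m′ n′)))
    transitive white m n black m′ n′ e = turn white m n m′ n′
      (trans (sym (reflect-cell m n)) (trans (cong reflect e) (reflect-reflect m′ n′)))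
    transitive black m n white m′ n′ e = turn black m n m′ n′ (trans (sym (reflect-cell m n)) e)

-- Decision procedures over cells and classes.

_≟ᶜ_ : DecidableEquality Colour
black ≟ᶜ black = yes refl
black ≟ᶜ white = no λ ()
white ≟ᶜ black = no λ ()
white ≟ᶜ white = yes refl

_≟ᶜᵉˡˡ_ : ∀ {k} → DecidableEquality (Cell k)
_≟ᶜᵉˡˡ_ = ≡-dec _≟_ _≟_

_≟ᶜˡᵃˢˢ_ : ∀ {k} → DecidableEquality (Class k)
_≟ᶜˡᵃˢˢ_ = ≡-dec _≟ᶜ_ _≟ᶜᵉˡˡ_

everyCell? : ∀ {k} {P : Cell k → Set} → Decidable P → Dec (∀ x → P x)
everyCell? P? = map′ uncurry (λ f a b → f (a , b)) (all? λ a → all? λ b → P? (a , b))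

someCell? : ∀ {k} {P : Cell k → Set} → Decidable P → Dec (∃ P)
someCell? P? = map′ (λ (a , b , p) → (a , b) , p) (λ ((a , b) , p) → a , b , p) (any? λ a → any? λ b → P? (a , b))

everyClass? : ∀ {k} {P : Class k → Set} → Decidable P → Dec (∀ x → P x)
everyClass? {P = P} P? = map′ join (λ f → (λ x → f (black , x)) , (λ x → f (white , x)))
  (everyCell? (λ x → P? (black , x)) ×-dec everyCell? (λ x → P? (white , x)))
  where
  join : (∀ x → P (black , x)) × (∀ x → P (white , x)) → ∀ x → P x
  join (f , g) (black , x) = f x
  join (f , g) (white , x) = g x

someClass? : ∀ {k} {P : Class k → Set} → Decidable P → Dec (∃ P)
someClass? {P = P} P? = map′ join split
  (someCell? (λ x → P? (black , x)) ⊎-dec someCell? (λ x → P? (white , x)))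
  where
  join : (∃ λ x → P (black , x)) ⊎ (∃ λ x → P (white , x)) → ∃ P
  join (inj₁ (x , p)) = (black , x) , p
  join (inj₂ (x , p)) = (white , x) , p
  split : ∃ P → (∃ λ x → P (black , x)) ⊎ (∃ λ x → P (white , x))
  split ((black , x) , p) = inj₁ (x , p)
  split ((white , x) , p) = inj₂ (x , p)

-- Edges and nonedges of the 1-skeleton of a polytope.

module Edges {d n} (ps : Vec (Vec ℤ d) n) where
  open Graph (skeleton ps) using (Adj)

  infixl 6 _⊞_
  _⊞_ : ∀ {d} → Vec ℤ d → Vec ℤ d → Vec ℤ d
  _⊞_ = zipWith ℤ._+_

  ⊙-⊞ : ∀ {d} (c p q : Vec ℤ d) → c ⊙ (p ⊞ q) ≡ c ⊙ p ℤ.+ c ⊙ q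
  ⊙-⊞ []       []       []       = refl
  ⊙-⊞ (c ∷ cs) (p ∷ ps) (q ∷ qs) =
    trans (cong (λ z → c ℤ.* (p ℤ.+ q) ℤ.+ z) (⊙-⊞ cs ps qs)) (regroup c p q (cs ⊙ ps) (cs ⊙ qs))
    where
    regroup : ∀ c p q a b → c ℤ.* (p ℤ.+ q) ℤ.+ (a ℤ.+ b) ≡ (c ℤ.* p ℤ.+ a) ℤ.+ (c ℤ.* q ℤ.+ b)
    regroup = solve-∀

  private
    point′ : Fin n → Vec ℤ d
    point′ = lookup ps

  ExposedBySum : Fin n → Fin n → Set
  ExposedBySum i j = let c = point′ i ⊞ point′ j in
    i ≢ j × c ⊙ point′ i ≡ c ⊙ point′ j × (∀ k → k ≢ i → k ≢ j → c ⊙ point′ k ℤ.< c ⊙ point′ i)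

  exposedBySum? : ∀ i j → Dec (ExposedBySum i j)
  exposedBySum? i j = ¬? (i ≟ j) ×-dec (_ ℤ.≟ _) ×-dec
    all? λ k → ¬? (k ≟ i) →-dec (¬? (k ≟ j) →-dec (_ ℤ.<? _))

  exposedBySum-adj : ∀ i j → ExposedBySum i j → Adj i j
  exposedBySum-adj i j (i≢j , e) = i≢j , point′ i ⊞ point′ j , e

  -- An equation between fourfold multiples of points: the midpoint of i and j is (2k + l + m) / 4.
  -- This form covers both kinds of combination in `Crossed`, with m = l or m = k.
  Balance : Fin n → Fin n → Fin n → Fin n → Fin n → Set
  Balance i j k l m = (point′ i ⊞ point′ i) ⊞ (point′ j ⊞ point′ j) ≡ (point′ k ⊞ point′ k) ⊞ (point′ l ⊞ point′ m)

  Outside : Fin n → Fin n → Fin n → Set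
  Outside i j k = k ≢ i × k ≢ j

  -- The midpoint of i and j is also a convex combination of two other
  -- points, with weights 1/2, 1/2 or 3/4, 1/4.
  Crossed : Fin n → Fin n → Set
  Crossed i j = ∃₂ λ k l → Outside i j k × Outside i j l × (Balance i j k l l ⊎ Balance i j k l k)

  crossed? : ∀ i j → Dec (Crossed i j)
  crossed? i j = any? λ k → any? λ l → outside? k ×-dec outside? l ×-dec (balance? k l l ⊎-dec balance? k l k)
    where
    outside? : ∀ k → Dec (Outside i j k)
    outside? k = ¬? (k ≟ i) ×-dec ¬? (k ≟ j)
    balance? : ∀ k l m → Dec (Balance i j k l m)
    balance? k l m = Vecₚ.≡-dec ℤ._≟_ _ _

  -- A functional that is maximal exactly at i and j is strictly smaller at k and l, whereas by
  -- linearity both sides of the balance have the same value.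
  crossed-nonadjacent : ∀ i j → Crossed i j → ¬ Adj i j
  crossed-nonadjacent i j (k , l , k∉ , l∉ , balance) (_ , c , e , exposed) = Sum.[ unbalanced l l∉ , unbalanced k k∉ ] balance
    where
    value : Fin n → ℤ
    value m = c ⊙ point′ m
    below : ∀ {m} → Outside i j m → value m ℤ.< value i
    below (m≢i , m≢j) = exposed _ m≢i m≢j
    ⊙-⊞⊞ : ∀ a b a′ b′ → c ⊙ ((point′ a ⊞ point′ b) ⊞ (point′ a′ ⊞ point′ b′)) ≡ (value a ℤ.+ value b) ℤ.+ (value a′ ℤ.+ value b′)
    ⊙-⊞⊞ a b a′ b′ = trans (⊙-⊞ c (point′ a ⊞ point′ b) (point′ a′ ⊞ point′ b′))
      (cong₂ ℤ._+_ (⊙-⊞ c (point′ a) (point′ b)) (⊙-⊞ c (point′ a′) (point′ b′)))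
    unbalanced : ∀ m → Outside i j m → ¬ Balance i j k l m
    unbalanced m m∉ b = ℤₚ.<-irrefl
      (trans (sym (⊙-⊞⊞ k k l m)) (trans (cong (c ⊙_) (sym b)) (trans (⊙-⊞⊞ i i j j)
        (cong (λ z → (value i ℤ.+ value i) ℤ.+ (z ℤ.+ z)) (sym e)))))
      (ℤₚ.+-mono-< (ℤₚ.+-mono-< (below k∉) (below k∉)) (ℤₚ.+-mono-< (below l∉) (below m∉)))

-- Labellings by the vertices of K₄, T and Q.

module C₂ = Cells 2
module C₆ = Cells 6
open Lattice Q-basis using () renaming (fold to fold₂)
open Lattice X₃-basis using () renaming (fold to fold₆)

-- Any bijection serves, as all permutations of the vertices are automorphisms of K₄.
K₄-label : Cell 2 → Fin 4
K₄-label (0F , 0F) = 0F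
K₄-label (0F , 1F) = 1F
K₄-label (1F , 0F) = 2F
K₄-label (1F , 1F) = 3F

K₄-labelling : Orbits.Labelling 2 fold₂ K₄
K₄-labelling = record
  { label           = K₄-label
  ; label-injective = λ {x} {y} → toWitness {a? = everyCell? λ x → everyCell? λ y →
      (K₄-label x ≟ K₄-label y) →-dec (x ≟ᶜᵉˡˡ y)} _ x y
  ; index           = λ v → proj₁ (onto v)
  ; label-index     = λ v → proj₂ (onto v)
  ; edge            = toWitness {a? = everyCell? λ x → all? λ d → ¬? (K₄-label (fold₂ (black , x)) ≟ _)} _
  ; edge⁻¹          = toWitness {a? = all? λ u → all? λ v → ¬? (u ≟ v) →-dec
      someCell? λ x → any? λ d → (joined? u v x d ⊎-dec joined? v u x d)} _
  }
  where
  onto : ∀ v → ∃ λ x → K₄-label x ≡ v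
  onto = toWitness {a? = all? λ v → someCell? λ x → K₄-label x ≟ v} _
  joined? : ∀ u v x d → Dec (u ≡ K₄-label (fold₂ (black , x)) × v ≡ K₄-label (fold₂ (white , C₂.neighbour x d)))
  joined? u v x d = (u ≟ _) ×-dec (v ≟ _)

module _ {k} .{{_ : NonZero k}} {A : Set} (κ : Class k → A) {d n} (ps : Vec (Vec ℤ d) n) (label : A → Fin n) where
  open Cells k using (neighbour)
  open Edges ps

  Joins : Fin n → Fin n → Cell k → Fin 3 → Set
  Joins u v x d = u ≡ label (κ (black , x)) × v ≡ label (κ (white , neighbour x d))

  Spans : Fin n → Fin n → Set
  Spans u v = ∃₂ λ x d → Joins u v x d ⊎ Joins v u x d

  ExposesEdges : Set
  ExposesEdges = ∀ x d → ExposedBySum (label (κ (black , x))) (label (κ (white , neighbour x d)))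

  exposesEdges? : Dec ExposesEdges
  exposesEdges? = everyCell? λ x → all? λ d → exposedBySum? (label (κ (black , x))) (label (κ (white , neighbour x d)))

  CrossesNonedges : Set
  CrossesNonedges = ∀ u v → u ≡ v ⊎ Spans u v ⊎ Crossed u v

  crossesNonedges? : Dec CrossesNonedges
  crossesNonedges? = all? λ u → all? λ v → (u ≟ v) ⊎-dec spans? u v ⊎-dec crossed? u v
    where
    joins? : ∀ u v x d → Dec (Joins u v x d)
    joins? u v x d = (u ≟ _) ×-dec (v ≟ _)
    spans? : ∀ u v → Dec (Spans u v)
    spans? u v = someCell? λ x → any? λ d → joins? u v x d ⊎-dec joins? v u x d

  -- Two vertices coincide, lie below a honeycomb edge, or are crossed. Adjacency in the skeleton
  -- rules out the first and the last case.
  skeletonLabelling : (∀ x y → label x ≡ label y → x ≡ y) → (∀ v → ∃ λ x → label x ≡ v) →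
    ExposesEdges → CrossesNonedges → Orbits.Labelling k κ (skeleton ps)
  skeletonLabelling injective onto exposes crosses = record
    { label           = label
    ; label-injective = injective _ _
    ; index           = λ v → proj₁ (onto v)
    ; label-index     = λ v → proj₂ (onto v)
    ; edge            = λ x d → exposedBySum-adj _ _ (exposes x d)
    ; edge⁻¹          = edge⁻¹
    }
    where
    edge⁻¹ : ∀ u v → Graph.Adj (skeleton ps) u v → Spans u v
    edge⁻¹ u v a with crosses u v
    ... | inj₁ u≡v          = contradiction u≡v (proj₁ a)
    ... | inj₂ (inj₁ spans) = spans
    ... | inj₂ (inj₂ cross) = contradiction a (crossed-nonadjacent u v cross)

tabulated : ∀ {k n} → Vec (Vec (Fin n) 2) k → Cell k → Fin n
tabulated table (a , b) = lookup (lookup table a) b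

-- One of the 24 isomorphisms, found by search.
T-label : Cell 6 → Fin 12
T-label = tabulated
  ((0F ∷ 3F ∷ []) ∷ (4F ∷ 1F ∷ []) ∷ (8F ∷ # 11 ∷ []) ∷
   (6F ∷ 9F ∷ []) ∷ (# 10 ∷ 7F ∷ []) ∷ (2F ∷ 5F ∷ []) ∷ [])

T-labelling : Orbits.Labelling 6 fold₆ T
T-labelling = skeletonLabelling fold₆ truncatedTetrahedronVertices T-label
  (toWitness {a? = everyCell? λ x → everyCell? λ y → (T-label x ≟ T-label y) →-dec (x ≟ᶜᵉˡˡ y)} _)
  (toWitness {a? = all? λ v → someCell? λ x → T-label x ≟ v} _)
  (toWitness {a? = exposesEdges? fold₆ truncatedTetrahedronVertices T-label} _)
  (toWitness {a? = crossesNonedges? fold₆ truncatedTetrahedronVertices T-label} _)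

-- The label of site c m n has the binary digits m, n and m + n + [c is black], mod 2.
Q-label : Class 2 → Fin 8
Q-label (white , x) = tabulated ((0F ∷ 6F ∷ []) ∷ (5F ∷ 3F ∷ []) ∷ []) x
Q-label (black , x) = tabulated ((1F ∷ 7F ∷ []) ∷ (4F ∷ 2F ∷ []) ∷ []) x

Q-labelling : Orbits.Labelling 2 id Q
Q-labelling = skeletonLabelling id cubeVertices Q-label
  (toWitness {a? = everyClass? λ x → everyClass? λ y → (Q-label x ≟ Q-label y) →-dec (x ≟ᶜˡᵃˢˢ y)} _)
  (toWitness {a? = all? λ v → someClass? λ x → Q-label x ≟ v} _)
  (toWitness {a? = exposesEdges? id cubeVertices Q-label} _)
  (toWitness {a? = crossesNonedges? id cubeVertices Q-label} _)

-- The labelling by the star graph.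

star : Fin 3 → Permutation′ 4
star i = transpose (inject₁ i) 3F

-- As `_∘ₚ_` composes from left to right, each step multiplies by a star transposition on the right,
-- as in the Cayley graph. The product of the three is a 4-cycle, so the walk closes after 12 steps,
-- the length of a zigzag through 6 white and 6 black classes.
walk : Permutation′ 4 → ℕ → Permutation′ 4
walk ξ zero    = ξ
walk ξ (suc n) = star (n mod 3) ∘ₚ walk ξ n

-- The second zigzag starts at the white class (0 , 1), which is joined to the black class (1 , 0)
-- of the first. That black class has label (1,4)(2,4)(3,4), and the transposition left over by the
-- zigzag there is (2,4), so the start is (1,4)(2,4)(3,4)(2,4) = (1,4)(2,3).
row : Fin 2 → Permutation′ 4
row 0F = Perm.id
row 1F = transpose 0F 3F ∘ₚ transpose 1F 2F

-- Along each zigzag of 𝓛 in the direction v₁ the edges are the three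
-- star transpositions, in cyclic order.
X₃-label : Class 6 → Permutation′ 4
X₃-label (white , a , b) = walk (row b) (2 ℕ.* toℕ a)
X₃-label (black , a , b) = walk (row b) (suc (2 ℕ.* toℕ a))

_≈?_ : (ξ η : Permutation′ 4) → Dec (ξ Perm.≈ η)
ξ ≈? η = all? λ i → (ξ ⟨$⟩ʳ i) ≟ (η ⟨$⟩ʳ i)

Collision : Fin 4 → Fin 4 → Fin 4 → Fin 4 → Set
Collision a b c d = a ≡ b ⊎ a ≡ c ⊎ a ≡ d ⊎ b ≡ c ⊎ b ≡ d ⊎ c ≡ d

Values : Permutation′ 4 → Fin 4 → Fin 4 → Fin 4 → Fin 4 → Set
Values ξ a b c d = ξ ⟨$⟩ʳ 0F ≡ a × ξ ⟨$⟩ʳ 1F ≡ b × ξ ⟨$⟩ʳ 2F ≡ c × ξ ⟨$⟩ʳ 3F ≡ d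

-- For surjectivity the search runs over all quadruples of values, a finite set on which equality is
-- decidable; quadruples with a repetition are set aside as collisions.
X₃-images : ∀ a b c d → Collision a b c d ⊎ ∃ λ x → Values (X₃-label x) a b c d
X₃-images = toWitness {a? = all? λ a → all? λ b → all? λ c → all? λ d →
  ((a ≟ b) ⊎-dec (a ≟ c) ⊎-dec (a ≟ d) ⊎-dec (b ≟ c) ⊎-dec (b ≟ d) ⊎-dec (c ≟ d)) ⊎-dec
  someClass? λ x → (_ ≟ _) ×-dec (_ ≟ _) ×-dec (_ ≟ _) ×-dec (_ ≟ _)} _

X₃-onto : ∀ ξ → ∃ λ x → X₃-label x Perm.≈ ξ
X₃-onto ξ = Sum.[ (λ collision → contradiction collision collisionless)
             , (λ (x , e₀ , e₁ , e₂ , e₃) → x , λ { 0F → e₀ ; 1F → e₁ ; 2F → e₂ ; 3F → e₃ }) ]′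
  (X₃-images (ξ ⟨$⟩ʳ 0F) (ξ ⟨$⟩ʳ 1F) (ξ ⟨$⟩ʳ 2F) (ξ ⟨$⟩ʳ 3F))
  where
  distinct : ∀ i j → i ≢ j → ξ ⟨$⟩ʳ i ≢ ξ ⟨$⟩ʳ j
  distinct i j i≢j e = i≢j (trans (sym (Perm.inverseˡ ξ)) (trans (cong (ξ ⟨$⟩ˡ_) e) (Perm.inverseˡ ξ)))

  collisionless : ¬ Collision (ξ ⟨$⟩ʳ 0F) (ξ ⟨$⟩ʳ 1F) (ξ ⟨$⟩ʳ 2F) (ξ ⟨$⟩ʳ 3F)
  collisionless (inj₁ e)                             = distinct 0F 1F (λ ()) e
  collisionless (inj₂ (inj₁ e))                      = distinct 0F 2F (λ ()) e
  collisionless (inj₂ (inj₂ (inj₁ e)))               = distinct 0F 3F (λ ()) e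
  collisionless (inj₂ (inj₂ (inj₂ (inj₁ e))))        = distinct 1F 2F (λ ()) e
  collisionless (inj₂ (inj₂ (inj₂ (inj₂ (inj₁ e))))) = distinct 1F 3F (λ ()) e
  collisionless (inj₂ (inj₂ (inj₂ (inj₂ (inj₂ e))))) = distinct 2F 3F (λ ()) e

X₃-edge : ∀ x d → ∃ λ i → X₃-label (white , C₆.neighbour x d) Perm.≈ (star i ∘ₚ X₃-label (black , x))
X₃-edge = toWitness {a? = everyCell? λ x → all? λ d → any? λ i →
  X₃-label (white , C₆.neighbour x d) ≈? (star i ∘ₚ X₃-label (black , x))} _

-- The converse of `X₃-edge` at the labels, where it can be decided: each star transposition is
-- carried by one of the edges at the class. `X₃-edge⁻¹` transfers it to arbitrary permutations by
-- `X₃-onto`.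
X₃-step : ∀ x i → ∃₂ λ z d →
  (x ≡ (black , z) × X₃-label (white , C₆.neighbour z d) Perm.≈ (star i ∘ₚ X₃-label x)) ⊎
  (x ≡ (white , C₆.neighbour z d) × X₃-label (black , z) Perm.≈ (star i ∘ₚ X₃-label x))
X₃-step = toWitness {a? = everyClass? λ x → all? λ i → someCell? λ z → any? λ d →
  ((x ≟ᶜˡᵃˢˢ (black , z)) ×-dec (X₃-label (white , C₆.neighbour z d) ≈? (star i ∘ₚ X₃-label x))) ⊎-dec
  ((x ≟ᶜˡᵃˢˢ (white , C₆.neighbour z d)) ×-dec (X₃-label (black , z) ≈? (star i ∘ₚ X₃-label x)))} _

X₃-Joined : Permutation′ 4 → Permutation′ 4 → Cell 6 → Fin 3 → Set
X₃-Joined ξ η z d = ξ Perm.≈ X₃-label (black , z) × η Perm.≈ X₃-label (white , C₆.neighbour z d)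

X₃-edge⁻¹ : ∀ ξ η → Graph.Adj X₃ ξ η → ∃₂ λ z d → X₃-Joined ξ η z d ⊎ X₃-Joined η ξ z d
X₃-edge⁻¹ ξ η (s , (i , s≈) , η≈) = joined (X₃-onto ξ)
  where
  η≈ξ∙star : η Perm.≈ (star i ∘ₚ ξ)
  η≈ξ∙star j = trans (η≈ j) (cong (ξ ⟨$⟩ʳ_) (s≈ j))

  joined : (∃ λ x → X₃-label x Perm.≈ ξ) → ∃₂ λ z d → X₃-Joined ξ η z d ⊎ X₃-Joined η ξ z d
  joined (x , x≈ξ) = located (X₃-step x i)
    where
    located : (∃₂ λ z d →
      (x ≡ (black , z) × X₃-label (white , C₆.neighbour z d) Perm.≈ (star i ∘ₚ X₃-label x)) ⊎
      (x ≡ (white , C₆.neighbour z d) × X₃-label (black , z) Perm.≈ (star i ∘ₚ X₃-label x))) →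
      ∃₂ λ z d → X₃-Joined ξ η z d ⊎ X₃-Joined η ξ z d
    located (z , d , inj₁ (x≡ , e)) = z , d , inj₁
      ( (λ j → trans (sym (x≈ξ j)) (cong (λ x → X₃-label x ⟨$⟩ʳ j) x≡))
      , λ j → trans (η≈ξ∙star j) (trans (sym (x≈ξ (star i ⟨$⟩ʳ j))) (sym (e j))) )
    located (z , d , inj₂ (x≡ , e)) = z , d , inj₂
      ( (λ j → trans (η≈ξ∙star j) (trans (sym (x≈ξ (star i ⟨$⟩ʳ j))) (sym (e j))))
      , λ j → trans (sym (x≈ξ j)) (cong (λ x → X₃-label x ⟨$⟩ʳ j) x≡) )

X₃-labelling : Orbits.Labelling 6 id X₃
X₃-labelling = record
  { label           = X₃-label
  ; label-injective = λ {x} {y} → toWitness {a? = everyClass? λ x → everyClass? λ y →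
      (X₃-label x ≈? X₃-label y) →-dec (x ≟ᶜˡᵃˢˢ y)} _ x y
  ; index           = λ ξ → proj₁ (X₃-onto ξ)
  ; label-index     = λ ξ → proj₂ (X₃-onto ξ)
  ; edge            = λ x d → let i , e = X₃-edge x d in star i , (i , λ _ → refl) , e
  ; edge⁻¹          = X₃-edge⁻¹
  }

-- The four actions and isomorphisms.

quotient : ∀ {k} .{{_ : NonZero k}} {A : Set} {κ : Class k → A} {H Γ} →
  Orbits.Classifies k κ H → Orbits.Labelling k κ Γ →
  Σ[ α ∈ HoneycombAction H ] Γ ≅ 𝓛 / HoneycombAction.action α
quotient {k} κ-classifies labelling =
  Orbits.honeycombAction k κ-classifies , Orbits.quotient≅ k κ-classifies labelling

K₄-classifies : Orbits.Classifies 2 (Lattice.fold Q-basis) G-K₄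
K₄-classifies = Lattice.G-classifies Q-basis

Q-classifies : Orbits.Classifies 2 id Λ-Q
Q-classifies = Lattice.Λ-classifies Q-basis

T-classifies : Orbits.Classifies 6 (Lattice.fold X₃-basis) G-T
T-classifies = Lattice.G-classifies X₃-basis

X₃-classifies : Orbits.Classifies 6 id Λ-X₃
X₃-classifies = Lattice.Λ-classifies X₃-basis

proposition2 : (Σ[ α ∈ HoneycombAction G-K₄ ] K₄ ≅ 𝓛 / HoneycombAction.action α)
    × (Σ[ α ∈ HoneycombAction Λ-Q ] Q ≅ 𝓛 / HoneycombAction.action α)
    × (Σ[ α ∈ HoneycombAction G-T ] T ≅ 𝓛 / HoneycombAction.action α)
    × (Σ[ α ∈ HoneycombAction Λ-X₃ ] X₃ ≅ 𝓛 / HoneycombAction.action α)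
proposition2 =
    quotient K₄-classifies K₄-labelling
  , quotient Q-classifies Q-labelling
  , quotient T-classifies T-labelling
  , quotient X₃-classifies X₃-labelling
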